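{- HyperLTL satisfiability restricted to sets of ultimately periodic traces (given a HyperLTL sentence $\varphi$, determine whether there is a set $T$ consisting only of ultimately periodic traces with $T \models \varphi$) is $\Sigma_1^1$-complete.
   Context: Let $\mathrm{AP}$ be a finite set of atomic propositions. A trace over $\mathrm{AP}$ is a map $t\colon \mathbb{N} \to 2^{\mathrm{AP}}$; $(2^{\mathrm{AP}})^\omega$ is the set of all traces. A trace $t$ is ultimately periodic if $t = x\cdot y^\omega$ for some $x,y\in(2^{\mathrm{AP}})^+$, i.e. there are $s,p>0$ with $t(n)=t(n+p)$ for all $n\ge s$. HyperLTL formulas over $\mathrm{AP}$ are given by $\varphi ::= \exists \pi.\ \varphi \mid \forall \pi.\ \varphi \mid \psi$ and $\psi ::= a_\pi \mid \neg\psi \mid \psi\vee\psi \mid \mathbf{X}\psi \mid \psi\,\mathbf{U}\,\psi$, where $a \in \mathrm{AP}$ and $\pi$ ranges over a fixed countable set $\mathcal{V}$ of trace variables. A sentence is a formula without free variables. A trace assignment is a partial map $\Pi\colon \mathcal{V} \to (2^{\mathrm{AP}})^\omega$; $\Pi_\emptyset$ is the one with empty domain; $\Pi[\pi\to t]$ is $\Pi$ updated to map $\pi$ to $t$; $\Pi[j,\infty)$ maps every $\pi$ in the domain of $\Pi$ to the suffix $\Pi(\pi)(j)\Pi(\pi)(j+1)\cdots$. For a set $T$ of traces: $(T,\Pi)\models a_\pi$ iff $a\in\Pi(\pi)(0)$; Boolean connectives are as usual; $(T,\Pi)\models\mathbf{X}\psi$ iff $(T,\Pi[1,\infty))\models\psi$;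 $(T,\Pi)\models\psi_1\mathbf{U}\psi_2$ iff there is $j\ge 0$ with $(T,\Pi[j,\infty))\models\psi_2$ and $(T,\Pi[j',\infty))\models\psi_1$ for all $0\le j'<j$; $(T,\Pi)\models\exists\pi.\varphi$ (resp. $\forall\pi.\varphi$) iff for some (resp. all) $t\in T$, $(T,\Pi[\pi\to t])\models\varphi$. For a sentence, $T\models\varphi$ means $(T,\Pi_\emptyset)\models\varphi$. Complexity: type 0 objects are natural numbers, type 1 objects are functions $\mathbb{N}\to\mathbb{N}$. Arithmetic formulas are over the signature $(0,1,+,\cdot,<)$, interpreted over $\mathbb{N}$. $\Sigma_1^1$ contains the sets of the form $\{x\in\mathbb{N} \mid \exists x_0\cdots\exists x_k.\ \psi(x,x_0,\ldots,x_k)\}$ where the $x_i$ are type 1 variables and $\psi$ is an arithmetic formula with arbitrary (existential and universal) quantification over type 0 objects. Decision problems are identified with subsets of $\mathbb{N}$ via a standard computable encoding of formulas, and completeness is with respect to computable many-one reductions. The input sentence may be over any finite set $\mathrm{AP}$. -}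

module Defs where

open import Data.Fin.Base using (Fin; toℕ)
open import Data.Fin.Subset using (Subset; _∈_)
open import Data.Maybe.Base as Maybe using (Maybe; just; nothing)
open import Data.Maybe.Relation.Unary.Any using (Any)
open import Data.Nat.Base using (ℕ; zero; suc; _+_; _*_; _<_; _≤_)
open import Data.Nat.Properties using (_≟_)
open import Data.Product.Base using (∃; ∃-syntax; _×_)
open import Data.Sum.Base using (_⊎_)
open import Data.Vec.Base using (Vec; []; _∷_; [_]; lookup)
open import Data.Vec.Relation.Binary.Pointwise.Inductive using (Pointwise)
open import Data.Bool.Base using (if_then_else_)
open import Function.Bundles using (_⇔_)
open import Level using (0ℓ)
import Level
open import Relation.Binary.PropositionalEquality using (_≡_; _≢_)
open import Relation.Nullary.Decidable.Core using (does)
open import Relation.Nullary.Negation.Core using (¬_)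
open import Relation.Unary using (Pred)

-- Throughout, logical connectives and quantifiers of object formulas are
-- interpreted by the corresponding type formers.  They have their classical
-- meaning under excluded middle.

------------------------------------------------------------------------
-- HyperLTL, over the set of atomic propositions AP = Fin n

Var : Set
Var = ℕ

Trace : ℕ → Set
Trace n = ℕ → Subset n

UltimatelyPeriodic : ∀ {n} → Pred (Trace n) 0ℓ
UltimatelyPeriodic t =
  ∃[ s ] ∃[ p ] 0 < s × 0 < p × (∀ k → s ≤ k → t k ≡ t (k + p))

infix  25 _⟨_⟩
infix  24 ¬′_ X_
infixl 23 _U_
infixl 22 _∨′_

data QuantifierFree (n : ℕ) : Set where
  _⟨_⟩ : Fin n → Var → QuantifierFree n
  ¬′_  : QuantifierFree n → QuantifierFree n
  _∨′_ : QuantifierFree n → QuantifierFree n → QuantifierFree n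
  X_   : QuantifierFree n → QuantifierFree n
  _U_  : QuantifierFree n → QuantifierFree n → QuantifierFree n

data HyperLTL (n : ℕ) : Set where
  ∃′ ∀′ : Var → HyperLTL n → HyperLTL n
  qf    : QuantifierFree n → HyperLTL n

Occurs : ∀ {n} → Var → QuantifierFree n → Set
Occurs π (a ⟨ π′ ⟩)  = π ≡ π′
Occurs π (¬′ ψ)      = Occurs π ψ
Occurs π (ψ₁ ∨′ ψ₂)  = Occurs π ψ₁ ⊎ Occurs π ψ₂
Occurs π (X ψ)       = Occurs π ψ
Occurs π (ψ₁ U ψ₂)   = Occurs π ψ₁ ⊎ Occurs π ψ₂

Free : ∀ {n} → Var → HyperLTL n → Set
Free π (∃′ π′ φ) = π ≢ π′ × Free π φ
Free π (∀′ π′ φ) = π ≢ π′ × Free π φ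
Free π (qf ψ)    = Occurs π ψ

Sentence : ∀ {n} → HyperLTL n → Set
Sentence φ = ∀ π → ¬ Free π φ

Assignment : ℕ → Set
Assignment n = Var → Maybe (Trace n)

Π∅ : ∀ {n} → Assignment n
Π∅ _ = nothing

_[_↦_] : ∀ {n} → Assignment n → Var → Trace n → Assignment n
(Π [ π ↦ t ]) π′ = if does (π′ ≟ π) then just t else Π π′

_[_,∞⟩ : ∀ {n} → Assignment n → ℕ → Assignment n
(Π [ j ,∞⟩) π = Maybe.map (λ t k → t (j + k)) (Π π)

infix 4 _⊨qf_ _,_⊨_ _⊨_

-- The satisfaction of a quantifier-free formula does not depend on the set
-- of traces.  An atom whose trace variable is unassigned counts as false;
-- this never happens in the evaluation of a sentence.
_⊨qf_ : ∀ {n} → Assignment n → QuantifierFree n → Set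
Π ⊨qf a ⟨ π ⟩  = Any (λ t → a ∈ t 0) (Π π)
Π ⊨qf ¬′ ψ     = ¬ (Π ⊨qf ψ)
Π ⊨qf ψ₁ ∨′ ψ₂ = Π ⊨qf ψ₁ ⊎ Π ⊨qf ψ₂
Π ⊨qf X ψ      = Π [ 1 ,∞⟩ ⊨qf ψ
Π ⊨qf ψ₁ U ψ₂  =
  ∃[ j ] (Π [ j ,∞⟩ ⊨qf ψ₂) × (∀ j′ → j′ < j → Π [ j′ ,∞⟩ ⊨qf ψ₁)

_,_⊨_ : ∀ {n} → Pred (Trace n) 0ℓ → Assignment n → HyperLTL n → Set
T , Π ⊨ ∃′ π φ = ∃[ t ] T t × (T , Π [ π ↦ t ] ⊨ φ)
T , Π ⊨ ∀′ π φ = ∀ t → T t → T , Π [ π ↦ t ] ⊨ φ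
T , Π ⊨ qf ψ   = Π ⊨qf ψ

_⊨_ : ∀ {n} → Pred (Trace n) 0ℓ → HyperLTL n → Set
T ⊨ φ = T , Π∅ ⊨ φ

UPSatisfiable : ∀ {n} → HyperLTL n → Set₁
UPSatisfiable {n} φ =
  ∃ λ (T : Pred (Trace n) 0ℓ) → (∀ t → T t → UltimatelyPeriodic t) × T ⊨ φ

------------------------------------------------------------------------
-- Encoding of formulas as natural numbers

triangle : ℕ → ℕ
triangle zero    = zero
triangle (suc k) = suc k + triangle k

-- The Cantor pairing function, a bijection between ℕ × ℕ and ℕ.
pair : ℕ → ℕ → ℕ
pair a b = triangle (a + b) + b

encodeQF : ∀ {n} → QuantifierFree n → ℕ
encodeQF (a ⟨ π ⟩)  = pair 0 (pair (toℕ a) π)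
encodeQF (¬′ ψ)     = pair 1 (encodeQF ψ)
encodeQF (ψ₁ ∨′ ψ₂) = pair 2 (pair (encodeQF ψ₁) (encodeQF ψ₂))
encodeQF (X ψ)      = pair 3 (encodeQF ψ)
encodeQF (ψ₁ U ψ₂)  = pair 4 (pair (encodeQF ψ₁) (encodeQF ψ₂))

encodeFormula : ∀ {n} → HyperLTL n → ℕ
encodeFormula (∃′ π φ) = pair 5 (pair π (encodeFormula φ))
encodeFormula (∀′ π φ) = pair 6 (pair π (encodeFormula φ))
encodeFormula (qf ψ)   = encodeQF ψ

-- The number of atomic propositions is part of the input.
encode : ∀ n → HyperLTL n → ℕ
encode n φ = pair n (encodeFormula φ)

UPSatisfiability : Pred ℕ (Level.suc 0ℓ)
UPSatisfiability x =
  ∃[ n ] ∃ λ (φ : HyperLTL n) → x ≡ encode n φ × Sentence φ × UPSatisfiable φ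

------------------------------------------------------------------------
-- Arithmetic formulas with k free type 1 variables and m free type 0
-- variables (as de Bruijn indices), and the class Σ¹₁

data Term (k m : ℕ) : Set where
  var     : Fin m → Term k m
  `0 `1   : Term k m
  _`+_    : Term k m → Term k m → Term k m
  _`*_    : Term k m → Term k m → Term k m
  _`$_    : Fin k → Term k m → Term k m

data Arithmetic (k m : ℕ) : Set where
  _`≡_ _`<_ : Term k m → Term k m → Arithmetic k m
  `¬_       : Arithmetic k m → Arithmetic k m
  _`∧_ _`∨_ : Arithmetic k m → Arithmetic k m → Arithmetic k m
  `∃ `∀     : Arithmetic k (suc m) → Arithmetic k m

module _ {k : ℕ} (F : Vec (ℕ → ℕ) k) where

  ⟦_⟧ᵗ : ∀ {m} → Term k m → Vec ℕ m → ℕ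
  ⟦ var i  ⟧ᵗ ρ = lookup ρ i
  ⟦ `0     ⟧ᵗ ρ = 0
  ⟦ `1     ⟧ᵗ ρ = 1
  ⟦ s `+ t ⟧ᵗ ρ = ⟦ s ⟧ᵗ ρ + ⟦ t ⟧ᵗ ρ
  ⟦ s `* t ⟧ᵗ ρ = ⟦ s ⟧ᵗ ρ * ⟦ t ⟧ᵗ ρ
  ⟦ i `$ t ⟧ᵗ ρ = lookup F i (⟦ t ⟧ᵗ ρ)

  ⟦_⟧ : ∀ {m} → Arithmetic k m → Vec ℕ m → Set
  ⟦ s `≡ t ⟧ ρ = ⟦ s ⟧ᵗ ρ ≡ ⟦ t ⟧ᵗ ρ
  ⟦ s `< t ⟧ ρ = ⟦ s ⟧ᵗ ρ < ⟦ t ⟧ᵗ ρ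
  ⟦ `¬ ψ   ⟧ ρ = ¬ ⟦ ψ ⟧ ρ
  ⟦ ψ `∧ χ ⟧ ρ = ⟦ ψ ⟧ ρ × ⟦ χ ⟧ ρ
  ⟦ ψ `∨ χ ⟧ ρ = ⟦ ψ ⟧ ρ ⊎ ⟦ χ ⟧ ρ
  ⟦ `∃ ψ   ⟧ ρ = ∃[ x ] ⟦ ψ ⟧ (x ∷ ρ)
  ⟦ `∀ ψ   ⟧ ρ = ∀ x → ⟦ ψ ⟧ (x ∷ ρ)

Σ¹₁ : ∀ {ℓ} → Pred ℕ ℓ → Set ℓ
Σ¹₁ A = ∃[ k ] ∃ λ (ψ : Arithmetic (suc k) 1) →
  ∀ x → A x ⇔ (∃ λ (F : Vec (ℕ → ℕ) (suc k)) → ⟦_⟧ F ψ [ x ])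

------------------------------------------------------------------------
-- Computable functions, in the sense of Kleene's μ-recursive functions

data Recursive : ℕ → Set where
  zeroᶠ : ∀ {n} → Recursive n
  sucᶠ  : Recursive 1
  proj  : ∀ {n} → Fin n → Recursive n
  comp  : ∀ {m n} → Recursive m → Vec (Recursive n) m → Recursive n
  prec  : ∀ {n} → Recursive n → Recursive (2 + n) → Recursive (suc n)
  μ     : ∀ {n} → Recursive (suc n) → Recursive n

infix 4 _·_⇓_

-- f · xs ⇓ y: the partial function f is defined at xs, with value y.
data _·_⇓_ : ∀ {n} → Recursive n → Vec ℕ n → ℕ → Set where
  zero⇓ : ∀ {n} {xs : Vec ℕ n} → zeroᶠ · xs ⇓ 0
  suc⇓  : ∀ {x} → sucᶠ · [ x ] ⇓ suc x
  proj⇓ : ∀ {n} {i : Fin n} {xs} → proj i · xs ⇓ lookup xs i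
  comp⇓ : ∀ {m n} {f : Recursive m} {gs : Vec (Recursive n) m} {xs ys z} →
          Pointwise (λ g y → g · xs ⇓ y) gs ys → f · ys ⇓ z →
          comp f gs · xs ⇓ z
  prec-zero⇓ : ∀ {n} {f : Recursive n} {g xs y} →
          f · xs ⇓ y → prec f g · zero ∷ xs ⇓ y
  prec-suc⇓ : ∀ {n} {f : Recursive n} {g xs k y z} →
          prec f g · k ∷ xs ⇓ y → g · k ∷ y ∷ xs ⇓ z →
          prec f g · suc k ∷ xs ⇓ z
  μ⇓    : ∀ {n} {f : Recursive (suc n)} {xs y} →
          (∀ i → i < y → ∃[ v ] f · i ∷ xs ⇓ suc v) → f · y ∷ xs ⇓ 0 →
          μ f · xs ⇓ y

Computable : (ℕ → ℕ) → Set
Computable f = ∃ λ (e : Recursive 1) → ∀ x → e · [ x ] ⇓ f x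

------------------------------------------------------------------------
-- Many-one reducibility and completeness

_≤ₘ_ : ∀ {ℓ₁ ℓ₂} → Pred ℕ ℓ₁ → Pred ℕ ℓ₂ → Set (ℓ₁ Level.⊔ ℓ₂)
A ≤ₘ B = ∃ λ (f : ℕ → ℕ) → Computable f × (∀ x → A x ⇔ B (f x))

Σ¹₁-Complete : ∀ {ℓ} → Pred ℕ ℓ → Set (Level.suc ℓ)
Σ¹₁-Complete {ℓ} A = Σ¹₁ A × (∀ (B : Pred ℕ ℓ) → Σ¹₁ B → B ≤ₘ A)

-- Membership.  An ultimately periodic trace is determined by a finite lasso, so
-- up to pointwise equality a model is a sequence of traces.  Satisfaction in
-- such a model is recorded by a table indexed by codes of formulas, of
-- assignments and of positions, and the recursion clauses of the table are
-- arithmetical.  Hence it suffices to guess the sequence and the tables.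
--
-- Hardness.  A trace on which each of five propositions holds exactly once is
-- a 5-tuple of numbers, and it is ultimately periodic.  Entries of tuples given
-- by different traces can be compared in HyperLTL, so a sentence ∃∀∀∃* can state
-- closure conditions on a 5-ary relation R.  Given ψ(x, F), a tuple in R makes a
-- claim: a subformula of ψ is true (or false) under an assignment, a term has
-- some value, or a + b = w, a * b = w, Fᵢ a = w.  R is closed if each of its
-- claims is justified by further claims in R and the claims about each Fᵢ are
-- functional.  A closed R making the claim ψ(x) exists iff ∃F ψ(x, F), and only
-- the claim ψ(x), not the closure conditions, depends on x.
module Submission where

open import Defs
open import Axiom.ExcludedMiddle using (ExcludedMiddle)
open import Data.Bool.Base as Bool using (Bool; true; false; if_then_else_; not)
open import Data.Empty using (⊥-elim)
open import Data.Fin.Base using (Fin; zero; suc; toℕ; fromℕ<)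
open import Data.Fin.Patterns
open import Data.Fin.Properties using (toℕ-injective; toℕ<n; toℕ-fromℕ<)
open import Data.Fin.Subset using (Subset; _∈_; outside)
open import Data.List.Base as List using (List; []; _∷_; _++_; applyUpTo; concatMap; allFin; length)
open import Data.List.Membership.Propositional using () renaming (_∈_ to _∈ˡ_)
open import Data.List.Membership.Propositional.Properties
  using (∈-allFin; ∈-lookup; ∈-map⁺; ∈-++⁺ˡ; ∈-++⁺ʳ)
open import Data.List.Relation.Unary.All as All using (All; []; _∷_)
import Data.List.Relation.Unary.All.Properties as All
open import Data.List.Relation.Unary.Any using (here; there; index)
open import Data.List.Relation.Unary.Any.Properties using (lookup-index)
open import Data.Maybe.Base using (Maybe; just; nothing)
open import Data.Maybe.Relation.Binary.Pointwise as Pointwise using (Pointwise; just; nothing)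
open import Data.Maybe.Relation.Unary.Any as Any using (just)
open import Data.Nat.Base
open import Data.Nat.DivMod using (m≡m%n+[m/n]*n; m%n<n)
open import Data.Nat.Induction using (<-wellFounded)
open import Data.Nat.Properties
open import Data.Product.Base
open import Data.Product.Function.NonDependent.Propositional using (_×-⇔_)
open import Data.Sum.Base as Sum using (_⊎_; inj₁; inj₂; [_,_]′)
open import Data.Sum.Function.Propositional using (_⊎-⇔_)
open import Data.Unit.Base using (⊤; tt)
open import Data.Vec.Base as Vec using (Vec; []; _∷_; [_]; lookup; tabulate; here; there)
open import Data.Vec.Properties using (lookup⇒[]=; []=⇒lookup; lookup∘tabulate; tabulate-cong)
open import Data.Vec.Relation.Binary.Pointwise.Inductive using ([]; _∷_)
open import Function.Base using (_∘_; _∋_; case_of_; id)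
open import Function.Bundles using (_⇔_; mk⇔; Equivalence)
import Function.Properties.Equivalence as ⇔
open import Induction.WellFounded using (Acc; acc)
open import Level as Level using (0ℓ; lift; lower)
open import Relation.Binary.Definitions using (tri<; tri≈; tri>)
open import Relation.Binary.PropositionalEquality hiding ([_])
open import Relation.Nullary using (Dec; yes; no; ¬_; does)
open import Relation.Nullary.Decidable using (dec-true; dec-false; decidable-stable; map′)

open Equivalence using (to; from)

-- Neither the guessed tables nor a closed relation need be minimal or well-founded: they may
-- contain junk. Each soundness proof therefore inducts on something outside them: the code of a
-- formula, the syntax of an arithmetic formula, or the second argument of a sum or product. In the
-- membership part a number is not known to be a code, so the well-formedness tables certify syntax
-- and binding of variables together, and the formula is rebuilt by recursion on the number. In the
-- hardness part claims come in both polarities, so that negation only flips a sign and every claim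
-- has positive evidence. A universal claim would need infinitely many justifications, while a
-- sentence offers finitely many existential traces; it is split into one copy per number, each copy
-- demanding the next. The second universal quantifier serves the functionality of the guessed
-- functions; sums and products are pinned down by recursion. The input is the position of one
-- proposition on the root trace, so it affects only a number of nested `X`.

private variable
  A B : Set
  k m n : ℕ


-- Cantor pairing and injectivity of the encodings

triangle-mono : ∀ {a b} → a ≤ b → triangle a ≤ triangle b
triangle-mono z≤n       = z≤n
triangle-mono (s≤s a≤b) = +-mono-≤ (s≤s a≤b) (triangle-mono a≤b)

-- The pairs with sum `s` occupy the block from `triangle s` up to, but excluding,
-- `triangle (suc s)`. Hence a code determines the sum, and then its offset in the block determines
-- the second component.
pair<triangle : ∀ a b → pair a b < triangle (suc (a + b))
pair<triangle a b = s≤s (begin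
  triangle (a + b) + b       ≡⟨ +-comm (triangle (a + b)) b ⟩
  b + triangle (a + b)       ≤⟨ +-monoˡ-≤ (triangle (a + b)) (m≤n+m b a) ⟩
  a + b + triangle (a + b)   ∎)
  where open ≤-Reasoning

pair-mono-sum : ∀ {a b c d} → a + b < c + d → pair a b < pair c d
pair-mono-sum {a} {b} {c} {d} lt = begin-strict
  pair a b               <⟨ pair<triangle a b ⟩
  triangle (suc (a + b)) ≤⟨ triangle-mono lt ⟩
  triangle (c + d)       ≤⟨ m≤m+n _ d ⟩
  pair c d               ∎
  where open ≤-Reasoning

-- The arguments are explicit because pair unfolds, which blocks inference.
pair-injective : ∀ a b c d → pair a b ≡ pair c d → a ≡ c × b ≡ d
pair-injective a b c d eq with <-cmp (a + b) (c + d)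
... | tri< lt _ _ = ⊥-elim (<⇒≢ (pair-mono-sum {a} {b} {c} {d} lt) eq)
... | tri> _ _ gt = ⊥-elim (<⇒≢ (pair-mono-sum {c} {d} {a} {b} gt) (sym eq))
... | tri≈ _ s _  = +-cancelʳ-≡ b a c (trans s (cong (c +_) (sym b≡d))) , b≡d
  where
  b≡d : b ≡ d
  b≡d = +-cancelˡ-≡ (triangle (a + b)) b d (trans eq (cong (λ s → triangle s + d) (sym s)))

pair≥ʳ : ∀ a b → b ≤ pair a b
pair≥ʳ a b = m≤n+m b (triangle (a + b))

pair≥ˡ : ∀ a b → a ≤ pair a b
pair≥ˡ a b = begin
  a                    ≤⟨ m≤m+n a b ⟩
  a + b                ≤⟨ sum≤triangle (a + b) ⟩
  triangle (a + b)     ≤⟨ m≤m+n _ b ⟩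
  pair a b             ∎
  where
  open ≤-Reasoning
  sum≤triangle : ∀ k → k ≤ triangle k
  sum≤triangle zero    = z≤n
  sum≤triangle (suc k) = m≤m+n (suc k) (triangle k)

-- A positive tag makes the body strictly smaller than the code. This is the measure for recursion
-- on numbers that are not yet known to be codes; the argument `a` is one less than the tag.
pair>ʳ : ∀ a b → b < pair (suc a) b
pair>ʳ a b = s≤s (m≤n+m b _)

tagQF bodyQF : QuantifierFree n → ℕ
tagQF (_ ⟨ _ ⟩) = 0
tagQF (¬′ _)    = 1
tagQF (_ ∨′ _)  = 2
tagQF (X _)     = 3
tagQF (_ U _)   = 4
bodyQF (a ⟨ π ⟩) = pair (toℕ a) π
bodyQF (¬′ ψ)    = encodeQF ψ
bodyQF (ψ ∨′ χ)  = pair (encodeQF ψ) (encodeQF χ)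
bodyQF (X ψ)     = encodeQF ψ
bodyQF (ψ U χ)   = pair (encodeQF ψ) (encodeQF χ)

encodeQF-split : (ψ : QuantifierFree n) → encodeQF ψ ≡ pair (tagQF ψ) (bodyQF ψ)
encodeQF-split (_ ⟨ _ ⟩) = refl
encodeQF-split (¬′ _)    = refl
encodeQF-split (_ ∨′ _)  = refl
encodeQF-split (X _)     = refl
encodeQF-split (_ U _)   = refl

tag<5 : (ψ : QuantifierFree n) → tagQF ψ < 5
tag<5 (_ ⟨ _ ⟩) = s≤s z≤n
tag<5 (¬′ _)    = s≤s (s≤s z≤n)
tag<5 (_ ∨′ _)  = s≤s (s≤s (s≤s z≤n))
tag<5 (X _)     = s≤s (s≤s (s≤s (s≤s z≤n)))
tag<5 (_ U _)   = s≤s (s≤s (s≤s (s≤s (s≤s z≤n))))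

encodeQF-injective : (ψ χ : QuantifierFree n) → encodeQF ψ ≡ encodeQF χ → ψ ≡ χ
encodeQF-injective ψ χ eq = by-tag ψ χ (proj₁ eqs) (proj₂ eqs)
  where
  eqs : tagQF ψ ≡ tagQF χ × bodyQF ψ ≡ bodyQF χ
  eqs = pair-injective _ (bodyQF ψ) _ (bodyQF χ)
          (trans (sym (encodeQF-split ψ)) (trans eq (encodeQF-split χ)))

  by-tag : ∀ ψ χ → tagQF {n = n} ψ ≡ tagQF χ → bodyQF ψ ≡ bodyQF χ → ψ ≡ χ
  by-tag (a ⟨ π ⟩) (b ⟨ ρ ⟩) refl q =
    let (a≡b , π≡ρ) = pair-injective (toℕ a) π (toℕ b) ρ q in
    cong₂ _⟨_⟩ (toℕ-injective a≡b) π≡ρ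
  by-tag (¬′ ψ) (¬′ χ) refl q = cong ¬′_ (encodeQF-injective ψ χ q)
  by-tag (X ψ) (X χ) refl q = cong X_ (encodeQF-injective ψ χ q)
  by-tag (ψ ∨′ ψ′) (χ ∨′ χ′) refl q =
    let (l , r) = pair-injective (encodeQF ψ) _ (encodeQF χ) _ q in
    cong₂ _∨′_ (encodeQF-injective ψ χ l) (encodeQF-injective ψ′ χ′ r)
  by-tag (ψ U ψ′) (χ U χ′) refl q =
    let (l , r) = pair-injective (encodeQF ψ) _ (encodeQF χ) _ q in
    cong₂ _U_ (encodeQF-injective ψ χ l) (encodeQF-injective ψ′ χ′ r)

-- The constructor `qf` contributes no tag of its own, so it is told apart from the quantifiers by
-- the tags of quantifier-free formulas lying below 5.
encodeQF≢quantifier : ∀ (ψ : QuantifierFree n) k c → encodeQF ψ ≢ pair (5 + k) c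
encodeQF≢quantifier ψ k c eq = <⇒≱ (tag<5 ψ) (subst (5 ≤_) (sym tag≡) (m≤m+n 5 k))
  where
  tag≡ : tagQF ψ ≡ 5 + k
  tag≡ = proj₁ (pair-injective (tagQF ψ) (bodyQF ψ) (5 + k) c (trans (sym (encodeQF-split ψ)) eq))

quantifier-injective : ∀ k l {π ρ c d} → pair k (pair π c) ≡ pair l (pair ρ d) →
                       k ≡ l × π ≡ ρ × c ≡ d
quantifier-injective k l {π} {ρ} {c} {d} eq =
  let (p , q) = pair-injective k (pair π c) l (pair ρ d) eq in p , pair-injective π c ρ d q

encodeFormula-injective : (φ χ : HyperLTL n) → encodeFormula φ ≡ encodeFormula χ → φ ≡ χ
encodeFormula-injective (∃′ π φ) (∃′ ρ χ) eq =
  let (_ , p , q) = quantifier-injective 5 5 {π} {ρ} {encodeFormula φ} {encodeFormula χ} eq in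
  cong₂ ∃′ p (encodeFormula-injective φ χ q)
encodeFormula-injective (∀′ π φ) (∀′ ρ χ) eq =
  let (_ , p , q) = quantifier-injective 6 6 {π} {ρ} {encodeFormula φ} {encodeFormula χ} eq in
  cong₂ ∀′ p (encodeFormula-injective φ χ q)
encodeFormula-injective (∃′ π φ) (∀′ ρ χ) eq =
  case proj₁ (quantifier-injective 5 6 {π} {ρ} {encodeFormula φ} {encodeFormula χ} eq) of λ ()
encodeFormula-injective (∀′ π φ) (∃′ ρ χ) eq =
  case proj₁ (quantifier-injective 6 5 {π} {ρ} {encodeFormula φ} {encodeFormula χ} eq) of λ ()
encodeFormula-injective (qf ψ) (qf χ) eq = cong qf (encodeQF-injective ψ χ eq)
encodeFormula-injective (∃′ π φ) (qf ψ) eq =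
  ⊥-elim (encodeQF≢quantifier ψ 0 (pair π (encodeFormula φ)) (sym eq))
encodeFormula-injective (∀′ π φ) (qf ψ) eq =
  ⊥-elim (encodeQF≢quantifier ψ 1 (pair π (encodeFormula φ)) (sym eq))
encodeFormula-injective (qf ψ) (∃′ π φ) eq =
  ⊥-elim (encodeQF≢quantifier ψ 0 (pair π (encodeFormula φ)) eq)
encodeFormula-injective (qf ψ) (∀′ π φ) eq =
  ⊥-elim (encodeQF≢quantifier ψ 1 (pair π (encodeFormula φ)) eq)

encode-injective : ∀ {m n} (φ : HyperLTL m) (χ : HyperLTL n) → encode m φ ≡ encode n χ →
                   (m , φ) ≡ (∃ HyperLTL ∋ (n , χ))
encode-injective {m} {n} φ χ eq with pair-injective m (encodeFormula φ) n (encodeFormula χ) eq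
... | refl , eq′ = cong (n ,_) (encodeFormula-injective φ χ eq′)

-- Pointwise equal assignments and invariance of satisfaction

infix 4 _≈_

-- Traces are functions, so without extensionality assignments can only be
-- compared pointwise.
_≈_ : Assignment n → Assignment n → Set
Π ≈ Π′ = ∀ π → Pointwise _≗_ (Π π) (Π′ π)

≈-sym : {Π Π′ : Assignment n} → Π ≈ Π′ → Π′ ≈ Π
≈-sym eq π = Pointwise.sym (λ p k → sym (p k)) (eq π)

≈-trans : {Π Π′ Π″ : Assignment n} → Π ≈ Π′ → Π′ ≈ Π″ → Π ≈ Π″
≈-trans eq eq′ π = Pointwise.trans (λ p q k → trans (p k) (q k)) (eq π) (eq′ π)

≈-shift : {Π Π′ : Assignment n} → Π ≈ Π′ → ∀ j → Π [ j ,∞⟩ ≈ Π′ [ j ,∞⟩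
≈-shift {Π = Π} {Π′} eq j π with Π π | Π′ π | eq π
... | just _  | just _  | just p  = just (λ k → p (j + k))
... | nothing | nothing | nothing = nothing

≈-update : {Π Π′ : Assignment n} {t t′ : Trace n} → Π ≈ Π′ → t ≗ t′ →
           ∀ π → Π [ π ↦ t ] ≈ Π′ [ π ↦ t′ ]
≈-update eq t≗t′ π ρ with does (ρ ≟ π)
... | true  = just t≗t′
... | false = eq ρ

update-hit : ∀ (Π : Assignment n) π t → (Π [ π ↦ t ]) π ≡ just t
update-hit Π π t = cong (λ b → if b then just t else Π π) (dec-true (π ≟ π) refl)

update-miss : ∀ (Π : Assignment n) {π} t {ρ} → ρ ≢ π → (Π [ π ↦ t ]) ρ ≡ Π ρ
update-miss Π {π} t {ρ} ρ≢π = cong (λ b → if b then just t else Π ρ) (dec-false (ρ ≟ π) ρ≢π)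

shift-0 : (Π : Assignment n) → Π [ 0 ,∞⟩ ≈ Π
shift-0 Π π with Π π
... | just _  = just (λ _ → refl)
... | nothing = nothing

shift-+ : ∀ (Π : Assignment n) i j → Π [ i ,∞⟩ [ j ,∞⟩ ≈ Π [ i + j ,∞⟩
shift-+ Π i j π with Π π
... | just t  = just (λ k → cong t (sym (+-assoc i j k)))
... | nothing = nothing

⊨qf-cong : {Π Π′ : Assignment n} → Π ≈ Π′ → ∀ ψ → Π ⊨qf ψ → Π′ ⊨qf ψ
⊨qf-cong {Π = Π} {Π′} eq (a ⟨ π ⟩) sat with Π π | Π′ π | eq π | sat
... | just _ | just _ | just p | just a∈ = just (subst (a ∈_) (p 0) a∈)
⊨qf-cong eq (¬′ ψ)   sat         = sat ∘ ⊨qf-cong (≈-sym eq) ψ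
⊨qf-cong eq (ψ ∨′ χ) (inj₁ sat)  = inj₁ (⊨qf-cong eq ψ sat)
⊨qf-cong eq (ψ ∨′ χ) (inj₂ sat)  = inj₂ (⊨qf-cong eq χ sat)
⊨qf-cong eq (X ψ)    sat         = ⊨qf-cong (≈-shift eq 1) ψ sat
⊨qf-cong eq (ψ U χ)  (j , q , p) =
  j , ⊨qf-cong (≈-shift eq j) χ q , λ i i<j → ⊨qf-cong (≈-shift eq i) ψ (p i i<j)

⊨-cong : {T : Trace n → Set} {Π Π′ : Assignment n} → Π ≈ Π′ →
         ∀ φ → T , Π ⊨ φ → T , Π′ ⊨ φ
⊨-cong eq (∃′ π φ) (t , t∈T , sat) = t , t∈T , ⊨-cong (≈-update eq (λ _ → refl) π) φ sat
⊨-cong eq (∀′ π φ) sat t t∈T       = ⊨-cong (≈-update eq (λ _ → refl) π) φ (sat t t∈T)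
⊨-cong eq (qf ψ)   sat             = ⊨qf-cong eq ψ sat

imply : Dec A → (A → B) → (¬ A) ⊎ B
imply (yes a) f = inj₂ (f a)
imply (no ¬a) f = inj₁ ¬a

implies : (¬ A) ⊎ B → A → B
implies (inj₁ ¬a) a = ⊥-elim (¬a a)
implies (inj₂ b)  _ = b

-- Membership in Σ¹₁

⟦⟧ᵗ-cong : {F G : Vec (ℕ → ℕ) k} → (∀ i → lookup F i ≗ lookup G i) →
           ∀ (t : Term k m) ρ → ⟦_⟧ᵗ F t ρ ≡ ⟦_⟧ᵗ G t ρ
⟦⟧ᵗ-cong F≗G (var i)  ρ = refl
⟦⟧ᵗ-cong F≗G `0       ρ = refl
⟦⟧ᵗ-cong F≗G `1       ρ = refl
⟦⟧ᵗ-cong F≗G (s `+ t) ρ = cong₂ _+_ (⟦⟧ᵗ-cong F≗G s ρ) (⟦⟧ᵗ-cong F≗G t ρ)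
⟦⟧ᵗ-cong F≗G (s `* t) ρ = cong₂ _*_ (⟦⟧ᵗ-cong F≗G s ρ) (⟦⟧ᵗ-cong F≗G t ρ)
⟦⟧ᵗ-cong {F = F} F≗G (i `$ t) ρ = trans (cong (lookup F i) (⟦⟧ᵗ-cong F≗G t ρ)) (F≗G i _)

-- Used to exchange a guessed function that satisfies `triangleClause` for `triangle` itself. After
-- that, pairing terms of the object language evaluate to `pair` by computation.
⟦⟧-cong : {F G : Vec (ℕ → ℕ) k} → (∀ i → lookup F i ≗ lookup G i) →
          ∀ (ψ : Arithmetic k m) {ρ} → ⟦_⟧ F ψ ρ → ⟦_⟧ G ψ ρ
⟦⟧-cong F≗G (s `≡ t) {ρ} = subst₂ _≡_ (⟦⟧ᵗ-cong F≗G s ρ) (⟦⟧ᵗ-cong F≗G t ρ)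
⟦⟧-cong F≗G (s `< t) {ρ} = subst₂ _<_ (⟦⟧ᵗ-cong F≗G s ρ) (⟦⟧ᵗ-cong F≗G t ρ)
⟦⟧-cong F≗G (`¬ ψ)   = λ h → h ∘ ⟦⟧-cong (λ i x → sym (F≗G i x)) ψ
⟦⟧-cong F≗G (ψ `∧ χ) = map (⟦⟧-cong F≗G ψ) (⟦⟧-cong F≗G χ)
⟦⟧-cong F≗G (ψ `∨ χ) = Sum.map (⟦⟧-cong F≗G ψ) (⟦⟧-cong F≗G χ)
⟦⟧-cong F≗G (`∃ ψ)   = map₂ (⟦⟧-cong F≗G ψ)
⟦⟧-cong F≗G (`∀ ψ)   = λ h x → ⟦⟧-cong F≗G ψ (h x)

-- The type 1 variables of the formula: the triangular numbers, the update and
-- the lookup function of coded assignments (lookup gives 0 for an unassigned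
-- variable and suc i for trace i), the traces with their preperiods and periods
-- (preperiod 0 marks an index which names no trace), and tables for being well
-- formed and closed under an assignment (of quantifier-free formulas and of
-- formulas) and for truth.
pattern Tri = 0F
pattern Upd = 1F
pattern Val = 2F
pattern Tra = 3F
pattern Pre = 4F
pattern Per = 5F
pattern Wqf = 6F
pattern Wff = 7F
pattern Tru = 8F

Tm : ℕ → Set
Tm = Term 9

Fm : ℕ → Set
Fm = Arithmetic 9

v0 : Tm (1 + m)
v0 = var 0F
v1 : Tm (2 + m)
v1 = var 1F
v2 : Tm (3 + m)
v2 = var 2F
v3 : Tm (4 + m)
v3 = var 3F
v4 : Tm (5 + m)
v4 = var 4F
v5 : Tm (6 + m)
v5 = var 5F

num : ℕ → Tm m
num zero    = `0
num (suc k) = `1 `+ num k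

`pair `value `wqf `wff : Tm m → Tm m → Tm m
`pair s t = (Tri `$ (s `+ t)) `+ t
`value e π = Val `$ `pair e π
`wqf c e = Wqf `$ `pair c e
`wff c e = Wff `$ `pair c e

`update `trace : Tm m → Tm m → Tm m → Tm m
`update e π i = Upd `$ `pair e (`pair π i)
`trace i k a = Tra `$ `pair i (`pair k a)

-- Tables of truth values are functions into ℕ, a positive entry standing for true.
pos : Tm m → Fm m
pos t = `0 `< t

`true : Tm m → Tm m → Tm m → Fm m
`true c e j = pos (Tru `$ `pair c (`pair e j))

infixr 6 _`⇔_
_`⇒_ _`⇔_ : Fm m → Fm m → Fm m
φ `⇒ ψ = (`¬ φ) `∨ ψ
φ `⇔ ψ = (φ `⇒ ψ) `∧ (ψ `⇒ φ)

-- From the outermost inwards, the variables of `updateClause` are the assignment, the variable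
-- bound, the trace index and the variable looked up; those of `periodClause` are the trace index,
-- the position and the proposition.
triangleClause emptyClause updateClause periodClause : Fm m
triangleClause =
  ((Tri `$ `0) `≡ `0) `∧ `∀ ((Tri `$ (`1 `+ v0)) `≡ ((`1 `+ v0) `+ (Tri `$ v0)))
emptyClause = `∀ (`value `0 v0 `≡ `0)
updateClause = `∀ (`∀ (`∀ (`∀
  (((v0 `≡ v2) `∧ (`value (`update v3 v2 v1) v0 `≡ (`1 `+ v1))) `∨
   ((`¬ (v0 `≡ v2)) `∧ (`value (`update v3 v2 v1) v0 `≡ `value v3 v0))))))
periodClause = `∀
  (((Pre `$ v0) `≡ `0) `∨
   (pos (Per `$ v0) `∧
    `∀ (`∀ ((v1 `< (Pre `$ v2)) `∨ (`trace v2 v1 v0 `≡ `trace v2 (v1 `+ (Per `$ v2)) v0)))))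

-- The cases are stated in context e ∷ c ∷ Γ: the formula with code c, under the
-- assignment with code e.  In atomCase, v5 is the number of propositions.  Each
-- case also fixes the truth value of c, since outside the codes of formulas the
-- truth table is not constrained.
atomCase : Fm (4 + m)
atomCase = `∃ (`∃
  ((v3 `≡ `pair `0 (`pair v1 v0)) `∧ ((v1 `< v5) `∧ (pos (`value v2 v0) `∧
   `∀ (`true v4 v3 v0 `⇔ `∃ ((`value v4 v2 `≡ (`1 `+ v0)) `∧ pos (`trace v0 v1 v3)))))))

negCase nextCase orCase untilCase existsCase forallCase : Fm (2 + m)
negCase = `∃
  ((v2 `≡ `pair (num 1) v0) `∧ (pos (`wqf v0 v1) `∧
   `∀ (`true v3 v2 v0 `⇔ (`¬ `true v1 v2 v0))))
nextCase = `∃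
  ((v2 `≡ `pair (num 3) v0) `∧ (pos (`wqf v0 v1) `∧
   `∀ (`true v3 v2 v0 `⇔ `true v1 v2 (v0 `+ `1))))
orCase = `∃ (`∃
  ((v3 `≡ `pair (num 2) (`pair v1 v0)) `∧ (pos (`wqf v1 v2) `∧ (pos (`wqf v0 v2) `∧
   `∀ (`true v4 v3 v0 `⇔ (`true v2 v3 v0 `∨ `true v1 v3 v0))))))
untilCase = `∃ (`∃
  ((v3 `≡ `pair (num 4) (`pair v1 v0)) `∧ (pos (`wqf v1 v2) `∧ (pos (`wqf v0 v2) `∧
   `∀ (`true v4 v3 v0 `⇔
       `∃ (`true v2 v4 (v1 `+ v0) `∧ `∀ ((v0 `< v1) `⇒ `true v4 v5 (v2 `+ v0))))))))
existsCase = `∃ (`∃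
  ((v3 `≡ `pair (num 5) (`pair v1 v0)) `∧ (`∀ (pos (`wff v1 (`update v3 v2 v0))) `∧
   (`true v3 v2 `0 `⇔ `∃ (pos (Pre `$ v0) `∧ `true v1 (`update v3 v2 v0) `0)))))
forallCase = `∃ (`∃
  ((v3 `≡ `pair (num 6) (`pair v1 v0)) `∧ (`∀ (pos (`wff v1 (`update v3 v2 v0))) `∧
   (`true v3 v2 `0 `⇔ `∀ (pos (Pre `$ v0) `⇒ `true v1 (`update v3 v2 v0) `0)))))

qfClause : Fm (2 + m)
qfClause = `∀ (`∀ ((`wqf v1 v0 `≡ `0) `∨
  (atomCase `∨ (negCase `∨ (orCase `∨ (nextCase `∨ untilCase))))))

formulaClause : Fm m
formulaClause = `∀ (`∀ ((`wff v1 v0 `≡ `0) `∨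
  (pos (`wqf v1 v0) `∨ (existsCase `∨ forallCase))))

-- By `emptyClause` the number 0 codes the empty assignment, so being well formed under it means
-- being a sentence.
upFormula : Arithmetic 9 1
upFormula = triangleClause `∧ `∃ (`∃
  ((v2 `≡ `pair v1 v0) `∧ (emptyClause `∧ (updateClause `∧ (periodClause `∧
   (qfClause `∧ (formulaClause `∧ (pos (`wff v0 `0) `∧ `true v0 `0 `0))))))))

∈-tabulate : ∀ {n} {f : Fin n → Bool} {a} → a ∈ tabulate f ⇔ f a ≡ true
∈-tabulate {f = f} {a} = mk⇔
  (λ a∈ → trans (sym (lookup∘tabulate f a)) ([]=⇒lookup a∈))
  (λ eq → lookup⇒[]= a (tabulate f) (trans (lookup∘tabulate f a) eq))

does⇔ : ∀ {P : Set} (d : Dec P) → does d ≡ true ⇔ P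
does⇔ (yes p) = mk⇔ (λ _ → p) (λ _ → refl)
does⇔ (no ¬p) = mk⇔ (λ ()) (⊥-elim ∘ ¬p)

fromTable : (ℕ → Trace n) → ℕ → Maybe (Trace n)
fromTable tr zero    = nothing
fromTable tr (suc i) = just (tr i)

-- From tables satisfying the clauses to a model

module Soundness
  (upd val tra pre per wqf wff tru : ℕ → ℕ) (n c x : ℕ)
  where

  F : Vec (ℕ → ℕ) 9
  F = triangle ∷ upd ∷ val ∷ tra ∷ pre ∷ per ∷ wqf ∷ wff ∷ tru ∷ []

  ρ : Vec ℕ 3
  ρ = c ∷ n ∷ x ∷ []

  iff : (¬ A ⊎ B) × (¬ B ⊎ A) → A ⇔ B
  iff (p , q) = mk⇔ (implies p) (implies q)

  tr : ℕ → Trace n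
  tr i k = tabulate (λ a → does (0 <? tra (pair i (pair k (toℕ a)))))

  ∈-tr : ∀ i k a → a ∈ tr i k ⇔ 0 < tra (pair i (pair k (toℕ a)))
  ∈-tr i k a =
    ⇔.trans (∈-tabulate {f = λ a → does (0 <? tra (pair i (pair k (toℕ a))))}) (does⇔ (0 <? _))

  env : ℕ → Assignment n
  env e π = fromTable tr (val (pair e π))

  -- Membership is propositional equality with an enumerated trace, so quantifiers over `T` become
  -- quantifiers over indices by matching on `refl`.
  T : Trace n → Set
  T t = ∃[ i ] 0 < pre i × t ≡ tr i

  T-periodic : ⟦_⟧ F periodClause ρ → ∀ t → T t → UltimatelyPeriodic t
  T-periodic h .(tr i) (i , 0<pre , refl) with h i
  ... | inj₁ pre≡0 = ⊥-elim (<⇒≢ 0<pre (sym pre≡0))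
  ... | inj₂ (0<per , eq) = pre i , per i , 0<pre , 0<per , λ k pre≤k →
    tabulate-cong λ a → cong (λ v → does (0 <? v))
      ([ (λ k<pre → ⊥-elim (<⇒≱ k<pre pre≤k)) , id ]′ (eq k (toℕ a)))

  env-update : ⟦_⟧ F updateClause ρ → ∀ e π i →
               env e [ π ↦ tr i ] ≈ env (upd (pair e (pair π i)))
  env-update h e π i π′ with h e π i π′
  ... | inj₁ (refl , eq)
        rewrite update-hit (env e) π (tr i) | eq = just (λ _ → refl)
  ... | inj₂ (π≢ , eq)
        rewrite update-miss (env e) (tr i) π≢ | eq = Pointwise.refl (λ _ → refl)

  -- A positive table entry suffices to rebuild the formula: the case that applies exhibits smaller
  -- codes, to which the recursion applies. Truth is claimed for all positions at once because `X`
  -- and `U` look at later ones.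
  qf-sound : ⟦_⟧ F qfClause ρ → ∀ {c} → Acc _<_ c → ∀ e → 0 < wqf (pair c e) →
    ∃ λ (ψ : QuantifierFree n) → c ≡ encodeQF ψ × (∀ π → Occurs π ψ → 0 < val (pair e π)) ×
    (∀ j → 0 < tru (pair c (pair e j)) ⇔ env e [ j ,∞⟩ ⊨qf ψ)
  qf-sound h {c} (acc rs) e 0<w with h c e
  ... | inj₁ w≡0 = ⊥-elim (<⇒≢ 0<w (sym w≡0))
  ... | inj₂ (inj₁ (a , π , refl , a<n , 0<val , tv)) =
    fromℕ< a<n ⟨ π ⟩ , cong (λ b → pair 0 (pair b π)) (sym (toℕ-fromℕ< a<n)) , (λ { _ refl → 0<val }) ,
    λ j → ⇔.trans (iff (tv j)) (atom j)
    where
    atom : ∀ j → (∃[ i ] val (pair e π) ≡ suc i × 0 < tra (pair i (pair j a))) ⇔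
                 (env e [ j ,∞⟩ ⊨qf fromℕ< a<n ⟨ π ⟩)
    atom j with val (pair e π)
    ... | zero  = mk⇔ (λ ()) (λ ())
    ... | suc i = mk⇔
      (λ { (_ , refl , p) → just (from (∈-tr i (j + 0) _)
             (subst₂ (λ k b → 0 < tra (pair i (pair k b)))
               (sym (+-identityʳ j)) (sym (toℕ-fromℕ< a<n)) p)) })
      (λ { (just p) → i , refl ,
             subst₂ (λ k b → 0 < tra (pair i (pair k b)))
               (+-identityʳ j) (toℕ-fromℕ< a<n) (to (∈-tr i (j + 0) _) p) })
  ... | inj₂ (inj₂ (inj₁ (d , refl , wd , tv))) with qf-sound h (rs (pair>ʳ 0 d)) e wd
  ...   | ψ , refl , occ , sat = ¬′ ψ , refl , occ , λ j →
    ⇔.trans (iff (tv j)) (mk⇔ (_∘ from (sat j)) (_∘ to (sat j)))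
  qf-sound h {c} (acc rs) e 0<w | inj₂ (inj₂ (inj₂ (inj₁ (d₁ , d₂ , refl , w₁ , w₂ , tv))))
    with qf-sound h (rs (≤-<-trans (pair≥ˡ d₁ d₂) (pair>ʳ 1 (pair d₁ d₂)))) e w₁
       | qf-sound h (rs (≤-<-trans (pair≥ʳ d₁ d₂) (pair>ʳ 1 (pair d₁ d₂)))) e w₂
  ... | ψ₁ , refl , occ₁ , sat₁ | ψ₂ , refl , occ₂ , sat₂ =
    ψ₁ ∨′ ψ₂ , refl , (λ π → [ occ₁ π , occ₂ π ]′) , λ j → ⇔.trans (iff (tv j)) (sat₁ j ⊎-⇔ sat₂ j)
  qf-sound h {c} (acc rs) e 0<w | inj₂ (inj₂ (inj₂ (inj₂ (inj₁ (d , refl , wd , tv)))))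
    with qf-sound h (rs (pair>ʳ 2 d)) e wd
  ... | ψ , refl , occ , sat = X ψ , refl , occ , λ j →
    ⇔.trans (iff (tv j)) (⇔.trans (sat (j + 1))
      (mk⇔ (⊨qf-cong (≈-sym (shift-+ (env e) j 1)) ψ) (⊨qf-cong (shift-+ (env e) j 1) ψ)))
  qf-sound h {c} (acc rs) e 0<w | inj₂ (inj₂ (inj₂ (inj₂ (inj₂ (d₁ , d₂ , refl , w₁ , w₂ , tv)))))
    with qf-sound h (rs (≤-<-trans (pair≥ˡ d₁ d₂) (pair>ʳ 3 (pair d₁ d₂)))) e w₁
       | qf-sound h (rs (≤-<-trans (pair≥ʳ d₁ d₂) (pair>ʳ 3 (pair d₁ d₂)))) e w₂
  ... | ψ₁ , refl , occ₁ , sat₁ | ψ₂ , refl , occ₂ , sat₂ =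
    ψ₁ U ψ₂ , refl , (λ π → [ occ₁ π , occ₂ π ]′) , λ j → ⇔.trans (iff (tv j)) (mk⇔
      (λ (i , p , q) → i , ⊨qf-cong (≈-sym (shift-+ (env e) j i)) ψ₂ (to (sat₂ (j + i)) p) ,
        λ i′ lt → ⊨qf-cong (≈-sym (shift-+ (env e) j i′)) ψ₁ (to (sat₁ (j + i′)) (implies (q i′) lt)))
      (λ (i , p , q) → i , from (sat₂ (j + i)) (⊨qf-cong (shift-+ (env e) j i) ψ₂ p) ,
        λ i′ → imply (i′ <? i) λ lt →
          from (sat₁ (j + i′)) (⊨qf-cong (shift-+ (env e) j i′) ψ₁ (q i′ lt))))

  -- Only position 0 matters here, as quantifiers never stand under temporal operators.
  Sound : ℕ → ℕ → Set
  Sound c e = ∃ λ (φ : HyperLTL n) → c ≡ encodeFormula φ × (∀ π → Free π φ → 0 < val (pair e π)) ×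
    (0 < tru (pair c (pair e 0)) ⇔ (T , env e ⊨ φ))

  module _ (upd-ok : ⟦_⟧ F updateClause ρ) (qf-ok : ⟦_⟧ F qfClause ρ)
           (ff-ok : ⟦_⟧ F formulaClause ρ) where

    unbind : ∀ {e π i ρ} → 0 < val (pair (upd (pair e (pair π i))) ρ) → ρ ≢ π → 0 < val (pair e ρ)
    unbind {e} {π} {i} {ρ} 0<v ρ≢π with upd-ok e π i ρ
    ... | inj₁ (ρ≡π , _) = ⊥-elim (ρ≢π ρ≡π)
    ... | inj₂ (_ , eq)  = subst (0 <_) eq 0<v

    -- The clauses demand a well-formed body under every index, even one that names no trace, so the
    -- update by 0 yields the formula even if `T` is empty. The other updates rebuild formulas with
    -- the same code, which injectivity identifies with the first.
    body : ∀ {e π d} → (∀ i → Sound d (upd (pair e (pair π i)))) →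
      ∃ λ (φ : HyperLTL n) → d ≡ encodeFormula φ × (∀ ρ → ρ ≢ π × Free ρ φ → 0 < val (pair e ρ)) ×
      (∀ i → 0 < tru (pair d (pair (upd (pair e (pair π i))) 0)) ⇔ (T , env e [ π ↦ tr i ] ⊨ φ))
    body {e} {π} {d} snd with snd 0
    ... | φ , refl , free , _ =
      φ , refl , (λ ρ (ρ≢π , fr) → unbind {e} {π} {0} (free ρ fr) ρ≢π) , sat
      where
      sat : ∀ i → 0 < tru (pair d (pair (upd (pair e (pair π i))) 0)) ⇔ (T , env e [ π ↦ tr i ] ⊨ φ)
      sat i with snd i
      ... | φ′ , eq , _ , s with encodeFormula-injective φ φ′ eq
      ...   | refl = ⇔.trans s (mk⇔ (⊨-cong (≈-sym (env-update upd-ok e π i)) φ)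
                                    (⊨-cong (env-update upd-ok e π i) φ))

    formula-sound : ∀ {c} → Acc _<_ c → ∀ e → 0 < wff (pair c e) → Sound c e
    formula-sound {c} (acc rs) e 0<w with ff-ok c e
    ... | inj₁ w≡0 = ⊥-elim (<⇒≢ 0<w (sym w≡0))
    ... | inj₂ (inj₁ w) with qf-sound qf-ok (<-wellFounded c) e w
    ...   | ψ , refl , occ , sat = qf ψ , refl , occ ,
      ⇔.trans (sat 0) (mk⇔ (⊨qf-cong (shift-0 (env e)) ψ) (⊨qf-cong (≈-sym (shift-0 (env e))) ψ))
    formula-sound (acc rs) e 0<w | inj₂ (inj₂ (inj₁ (π , d , refl , w , tv)))
      with body {e} {π} (λ i →
             formula-sound (rs (≤-<-trans (pair≥ʳ π d) (pair>ʳ 4 (pair π d)))) _ (w i))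
    ... | φ , refl , free , sat = ∃′ π φ , refl , free , ⇔.trans (iff tv) (mk⇔
      (λ (i , p , s) → tr i , (i , p , refl) , to (sat i) s)
      (λ { (_ , (i , p , refl) , s) → i , p , from (sat i) s }))
    formula-sound (acc rs) e 0<w | inj₂ (inj₂ (inj₂ (π , d , refl , w , tv)))
      with body {e} {π} (λ i →
             formula-sound (rs (≤-<-trans (pair≥ʳ π d) (pair>ʳ 5 (pair π d)))) _ (w i))
    ... | φ , refl , free , sat = ∀′ π φ , refl , free , ⇔.trans (iff tv) (mk⇔
      (λ { s _ (i , p , refl) → to (sat i) (implies (s i) p) })
      (λ s i → imply (0 <? pre i) λ p → from (sat i) (s (tr i) (i , p , refl))))

up-sound : ∀ x → (∃ λ F → ⟦_⟧ F upFormula [ x ]) → UPSatisfiability x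
up-sound x (tri ∷ upd ∷ val ∷ tra ∷ pre ∷ per ∷ wqf ∷ wff ∷ tru ∷ [] , sat@((tri-0 , tri-suc) , _)) =
  sound (⟦⟧-cong {F = tri ∷ rest} {G = triangle ∷ rest} (λ { 0F → tri≗ ; (suc i) _ → refl })
    upFormula {[ x ]} sat)
  where
  rest : Vec (ℕ → ℕ) 8
  rest = upd ∷ val ∷ tra ∷ pre ∷ per ∷ wqf ∷ wff ∷ tru ∷ []

  tri≗ : tri ≗ triangle
  tri≗ zero    = tri-0
  tri≗ (suc k) = trans (tri-suc k) (cong (suc k +_) (tri≗ k))

  sound : ⟦_⟧ (triangle ∷ rest) upFormula [ x ] → UPSatisfiability x
  sound (_ , n , c , refl , emp , upd-ok , per-ok , qf-ok , ff-ok , w , tv) =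
    let open Soundness upd val tra pre per wqf wff tru n c x
        (φ , c≡ , free , s) = formula-sound upd-ok qf-ok ff-ok (<-wellFounded c) 0 w
    in n , φ , cong (pair n) c≡ , (λ π fr → <⇒≢ (free π fr) (sym (emp π))) , T , T-periodic per-ok ,
       ⊨-cong (λ π → subst (λ v → Pointwise _≗_ (fromTable tr v) nothing) (sym (emp π)) nothing)
         φ (to s tv)

-- Codes of lists and letters; traces as lassos

encodeList : (A → ℕ) → List A → ℕ
encodeList enc []       = 0
encodeList enc (a ∷ as) = suc (pair (enc a) (encodeList enc as))

encodeList-injective : (enc : A → ℕ) → (∀ a b → enc a ≡ enc b → a ≡ b) →
                       ∀ as bs → encodeList enc as ≡ encodeList enc bs → as ≡ bs
encodeList-injective enc inj []       []       eq = refl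
encodeList-injective enc inj (a ∷ as) (b ∷ bs) eq =
  let (p , q) = pair-injective (enc a) _ (enc b) _ (suc-injective eq) in
  cong₂ _∷_ (inj a b p) (encodeList-injective enc inj as bs q)

encodeSubset : Subset n → ℕ
encodeSubset []      = 0
encodeSubset (b ∷ p) = pair (if b then 1 else 0) (encodeSubset p)

encodeSubset-injective : (p q : Subset n) → encodeSubset p ≡ encodeSubset q → p ≡ q
encodeSubset-injective [] [] eq = refl
encodeSubset-injective (b ∷ p) (c ∷ q) eq =
  let (h , t) = pair-injective _ (encodeSubset p) _ (encodeSubset q) eq in
  cong₂ _∷_ (bit-injective b c h) (encodeSubset-injective p q t)
  where
  bit-injective : ∀ b c → (ℕ ∋ (if b then 1 else 0)) ≡ (if c then 1 else 0) → b ≡ c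
  bit-injective true  true  _ = refl
  bit-injective false false _ = refl

memberBit : Subset n → ℕ → ℕ
memberBit []      _       = 0
memberBit (b ∷ p) zero    = if b then 1 else 0
memberBit (b ∷ p) (suc a) = memberBit p a

memberBit-∈ : ∀ (p : Subset n) a → 0 < memberBit p (toℕ a) ⇔ a ∈ p
memberBit-∈ (true  ∷ p) zero = mk⇔ (λ _ → here) (λ _ → s≤s z≤n)
memberBit-∈ (false ∷ p) zero = mk⇔ (λ ()) (λ ())
memberBit-∈ (b ∷ p) (suc a)  =
  mk⇔ (there ∘ to (memberBit-∈ p a)) (λ { (there a∈) → from (memberBit-∈ p a) a∈ })

nth : List (Subset n) → ℕ → Subset n
nth []      _       = Vec.replicate _ outside
nth (p ∷ w) zero    = p
nth (p ∷ w) (suc k) = nth w k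

nth-applyUpTo : ∀ (t : Trace n) N {k} → k < N → nth (applyUpTo t N) k ≡ t k
nth-applyUpTo t (suc N) {zero}  _         = refl
nth-applyUpTo t (suc N) {suc k} (s≤s k<N) = nth-applyUpTo (t ∘ suc) N k<N

-- A preperiod s, a period minus one, and the first letters of a trace.
Lasso : ℕ → Set
Lasso n = ℕ × ℕ × List (Subset n)

encodeLasso : Lasso n → ℕ
encodeLasso (s , q , w) = pair s (pair q (encodeList encodeSubset w))

encodeLasso-injective : (l l′ : Lasso n) → encodeLasso l ≡ encodeLasso l′ → l ≡ l′
encodeLasso-injective (s , q , w) (s′ , q′ , w′) eq
  with pair-injective s (pair q (encodeList encodeSubset w)) s′ _ eq
... | refl , eq′ with pair-injective q (encodeList encodeSubset w) q′ _ eq′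
... | refl , eq″ with encodeList-injective encodeSubset encodeSubset-injective w w′ eq″
... | refl = refl

-- The representative of position `k` among the first `s + suc q` positions. Storing the period
-- minus one makes the divisor visibly nonzero.
fold : ℕ → ℕ → ℕ → ℕ
fold s q k = if does (k <? s) then k else s + (k ∸ s) % suc q

unroll : Lasso n → Trace n
unroll (s , q , w) k = nth w (fold s q k)

fold-bound : ∀ s q k → fold s q k < s + suc q
-- `does (k <? s)` computes to `k <ᵇ s`, so matching on the latter reduces `fold`.
fold-bound s q k with k <ᵇ s in eq
... | true  = ≤-trans (<ᵇ⇒< k s (subst Bool.T (sym eq) _)) (m≤m+n s _)
... | false = +-monoʳ-< s (m%n<n (k ∸ s) (suc q))

module _ {t : Trace n} {s q : ℕ} (periodic : ∀ k → s ≤ k → t k ≡ t (k + suc q)) where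

  skip-periods : ∀ {r} → s ≤ r → ∀ m → t (r + m * suc q) ≡ t r
  skip-periods {r} s≤r zero    = cong t (+-identityʳ r)
  skip-periods {r} s≤r (suc m) = begin
    t (r + (suc q + m * suc q)) ≡⟨ cong (λ y → t (r + y)) (+-comm (suc q) _) ⟩
    t (r + (m * suc q + suc q)) ≡⟨ cong t (+-assoc r _ _) ⟨
    t (r + m * suc q + suc q)   ≡⟨ periodic _ (≤-trans s≤r (m≤m+n r _)) ⟨
    t (r + m * suc q)           ≡⟨ skip-periods s≤r m ⟩
    t r                         ∎
    where open ≡-Reasoning

  fold-periodic : ∀ k → t (fold s q k) ≡ t k
  fold-periodic k with k <ᵇ s in eq
  ... | true  = refl
  ... | false = begin
    t (s + j % suc q)                         ≡⟨ skip-periods (m≤m+n s _) (j / suc q) ⟨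
    t (s + j % suc q + j / suc q * suc q)     ≡⟨ cong t (+-assoc s _ _) ⟩
    t (s + (j % suc q + j / suc q * suc q))   ≡⟨ cong (λ y → t (s + y)) (m≡m%n+[m/n]*n j (suc q)) ⟨
    t (s + j)                                 ≡⟨ cong t (m+[n∸m]≡n s≤k) ⟩
    t k                                       ∎
    where
    open ≡-Reasoning
    j = k ∸ s
    s≤k : s ≤ k
    s≤k = ≮⇒≥ λ k<s → subst Bool.T eq (<⇒<ᵇ k<s)

  unroll-fold : unroll (s , q , applyUpTo t (s + suc q)) ≗ t
  unroll-fold k = trans (nth-applyUpTo t (s + suc q) (fold-bound s q k)) (fold-periodic k)

find : List (ℕ × ℕ) → Var → ℕ
find []            _ = 0
find ((ρ , i) ∷ l) π = if does (π ≟ ρ) then suc i else find l π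

find-hit : ∀ l {π ρ i} → ρ ≡ π → find ((π , i) ∷ l) ρ ≡ suc i
find-hit l {π} {ρ} {i} ρ≡π = cong (λ b → if b then suc i else find l ρ) (dec-true (ρ ≟ π) ρ≡π)

find-miss : ∀ l {π ρ i} → ρ ≢ π → find ((π , i) ∷ l) ρ ≡ find l ρ
find-miss l {π} {ρ} {i} ρ≢π = cong (λ b → if b then suc i else find l ρ) (dec-false (ρ ≟ π) ρ≢π)

-- From a model to tables satisfying the clauses

module Classical (em : ExcludedMiddle 0ℓ) where

  -- Excluded middle decides whether a number is a code, so an injective coding has a total left
  -- inverse. It only serves to define type 1 objects, which need not be computable.
  invert : (enc : A → ℕ) → (∀ a b → enc a ≡ enc b → a ≡ b) → A →
           ∃ λ (dec : ℕ → A) → ∀ a → dec (enc a) ≡ a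
  invert {A = A} enc inj default = (λ x → preimage (em {∃[ a ] enc a ≡ x})) , inverse
    where
    preimage : ∀ {x} → Dec (∃[ a ] enc a ≡ x) → A
    preimage (yes (a , _)) = a
    preimage (no _)        = default

    inverse : ∀ a → preimage (em {∃[ b ] enc b ≡ enc a}) ≡ a
    inverse a with em {∃[ b ] enc b ≡ enc a}
    ... | yes (b , eq) = inj b a eq
    ... | no ¬∃        = ⊥-elim (¬∃ (a , refl))

  unpairing : ∃ λ (unpair : ℕ → ℕ × ℕ) → ∀ ab → unpair (uncurry pair ab) ≡ ab
  unpairing = invert (uncurry pair)
    (λ (a , b) (c , d) eq → let (p , q) = pair-injective a b c d eq in cong₂ _,_ p q) (0 , 0)

  opaque
    -- Turns a binary function into a type 1 object; nesting gives more arguments. It is opaque so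
    -- that proofs go through `table-pair` and never unfold the classical decoder.
    table : (ℕ → ℕ → ℕ) → ℕ → ℕ
    table f = uncurry f ∘ proj₁ unpairing

    table-pair : ∀ f a b → table f (pair a b) ≡ f a b
    table-pair f a b = cong (uncurry f) (proj₂ unpairing (a , b))

  opaque
    χ : Set → ℕ
    χ P = if does (em {P}) then 1 else 0

    χ⁺ : ∀ {P} → P → 0 < χ P
    χ⁺ {P} p with em {P}
    ... | yes _ = s≤s z≤n
    ... | no ¬p = ⊥-elim (¬p p)

    χ⁻ : ∀ {P} → 0 < χ P → P
    χ⁻ {P} 0<χ with em {P} | 0<χ
    ... | yes p | _ = p

  relation : (ℕ → ℕ → Set) → ℕ → ℕ
  relation R = table (λ a b → χ (R a b))

  relation-pair : ∀ R a b → 0 < relation R (pair a b) ⇔ R a b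
  relation-pair R a b = mk⇔
    (χ⁻ ∘ subst (0 <_) (table-pair _ a b))
    (subst (0 <_) (sym (table-pair _ a b)) ∘ χ⁺)

  iff⁻¹ : A ⇔ B → (¬ A ⊎ B) × (¬ B ⊎ A)
  iff⁻¹ e = imply em (to e) , imply em (from e)

  zero-or : ∀ {k} → (0 < k → A) → k ≡ 0 ⊎ A
  zero-or {k = zero}  f = inj₁ refl
  zero-or {k = suc k} f = inj₂ (f (s≤s z≤n))

  module Completeness (T : Trace n → Set) (T-periodic : ∀ t → T t → UltimatelyPeriodic t) where

    decodeLasso : ∃ λ (dec : ℕ → Lasso n) → ∀ l → dec (encodeLasso l) ≡ l
    decodeLasso = invert encodeLasso encodeLasso-injective (0 , 0 , [])

    decodeEnv : ∃ λ (dec : ℕ → List (ℕ × ℕ)) → ∀ l → dec (encodeList (uncurry pair) l) ≡ l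
    decodeEnv = invert _ (encodeList-injective (uncurry pair)
      (λ (a , b) (c , d) eq → let (p , q) = pair-injective a b c d eq in cong₂ _,_ p q)) []

    bindings : ℕ → List (ℕ × ℕ)
    bindings = proj₁ decodeEnv

    tr : ℕ → Trace n
    tr i = unroll (proj₁ decodeLasso i)

    -- Every number decodes to some lasso, so an index names a trace only if the unrolled lasso
    -- agrees pointwise with a member of the model.
    Member : ℕ → Set
    Member i = ∃[ t ] T t × tr i ≗ t

    -- Both numbers come from the member of `T` that witnesses `Member i`, not from the lasso coded
    -- by `i`. The preperiod is therefore positive exactly when `i` names a trace.
    period : ∀ {i} → Dec (Member i) → ℕ × ℕ
    period (yes (t , t∈T , _)) = let (s , p , _) = T-periodic t t∈T in s , p
    period (no _)              = 0 , 0

    bind : ℕ → Var → ℕ → ℕ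
    bind e π i = encodeList (uncurry pair) ((π , i) ∷ bindings e)

    env : ℕ → Assignment n
    env e π = fromTable tr (find (bindings e) π)

    -- The truth and well-formedness tables are defined by their intended meaning, not by recursion;
    -- the clauses then follow from the semantic equations, one case per constructor.
    upd val tra pre per wqf wff tru : ℕ → ℕ
    upd = table (λ e → table (bind e))
    val = table (λ e → find (bindings e))
    tra = table (λ i → table (λ k a → memberBit (tr i k) a))
    pre i = proj₁ (period (em {Member i}))
    per i = proj₂ (period (em {Member i}))
    wqf = relation λ c e → ∃ λ (ψ : QuantifierFree n) →
      c ≡ encodeQF ψ × (∀ π → Occurs π ψ → 0 < val (pair e π))
    wff = relation λ c e → ∃ λ (φ : HyperLTL n) →
      c ≡ encodeFormula φ × (∀ π → Free π φ → 0 < val (pair e π))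
    tru = table λ c → relation λ e j → ∃ λ (φ : HyperLTL n) →
      c ≡ encodeFormula φ × (T , env e [ j ,∞⟩ ⊨ φ)

    upd-pair : ∀ e π i → upd (pair e (pair π i)) ≡ bind e π i
    upd-pair e π i = trans (table-pair _ e (pair π i)) (table-pair _ π i)

    val-pair : ∀ e π → val (pair e π) ≡ find (bindings e) π
    val-pair = table-pair _

    tra-pair : ∀ i k a → tra (pair i (pair k a)) ≡ memberBit (tr i k) a
    tra-pair i k a = trans (table-pair _ i (pair k a)) (table-pair _ k a)

    tru-pair : ∀ (φ : HyperLTL n) e j →
      0 < tru (pair (encodeFormula φ) (pair e j)) ⇔ (T , env e [ j ,∞⟩ ⊨ φ)
    tru-pair φ e j rewrite table-pair (λ c → relation λ e j → ∃ λ (φ : HyperLTL n) →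
        c ≡ encodeFormula φ × (T , env e [ j ,∞⟩ ⊨ φ)) (encodeFormula φ) (pair e j) =
      ⇔.trans (relation-pair _ e j) (mk⇔
        (λ (φ′ , eq , sat) → subst (T , env e [ j ,∞⟩ ⊨_) (sym (encodeFormula-injective φ φ′ eq)) sat)
        (λ sat → φ , refl , sat))

    bindings-bind : ∀ e π i → bindings (bind e π i) ≡ (π , i) ∷ bindings e
    bindings-bind e π i = proj₂ decodeEnv ((π , i) ∷ bindings e)

    env-bind : ∀ e π i → env (bind e π i) ≈ env e [ π ↦ tr i ]
    env-bind e π i ρ rewrite bindings-bind e π i with ρ ≡ᵇ π
    ... | true  = just (λ _ → refl)
    ... | false = Pointwise.refl (λ _ → refl)

    F : Vec (ℕ → ℕ) 9
    F = triangle ∷ upd ∷ val ∷ tra ∷ pre ∷ per ∷ wqf ∷ wff ∷ tru ∷ []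

    empty-holds : ∀ {m} {ρ : Vec ℕ m} → ⟦_⟧ F emptyClause ρ
    empty-holds π = trans (val-pair 0 π) (cong (λ l → find l π) (proj₂ decodeEnv []))

    update-val : ∀ e π i ρ → val (pair (upd (pair e (pair π i))) ρ) ≡ find ((π , i) ∷ bindings e) ρ
    update-val e π i ρ = trans (cong (λ u → val (pair u ρ)) (upd-pair e π i))
      (trans (val-pair _ ρ) (cong (λ l → find l ρ) (bindings-bind e π i)))

    update-holds : ∀ {m} {ρ : Vec ℕ m} → ⟦_⟧ F updateClause ρ
    update-holds e π i ρ with ρ ≟ π | update-val e π i ρ
    ... | yes ρ≡π | eq = inj₁ (ρ≡π , trans eq (find-hit (bindings e) ρ≡π))
    ... | no  ρ≢π | eq = inj₂ (ρ≢π , trans eq (trans (find-miss (bindings e) ρ≢π) (sym (val-pair e ρ))))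

    tr-periodic : ∀ i (d : Dec (Member i)) → 0 < proj₁ (period d) →
      0 < proj₂ (period d) × (∀ k → proj₁ (period d) ≤ k → tr i k ≡ tr i (k + proj₂ (period d)))
    tr-periodic i (yes (t , t∈T , eq)) _ =
      let (s , p , _ , 0<p , per) = T-periodic t t∈T in
      0<p , λ k s≤k → trans (eq k) (trans (per k s≤k) (sym (eq (k + p))))

    period-holds : ∀ {m} {ρ : Vec ℕ m} → ⟦_⟧ F periodClause ρ
    period-holds i = zero-or λ 0<pre →
      let (0<per , eq) = tr-periodic i em 0<pre in
      0<per , λ k a → case k <? pre i of λ where
        (yes lt) → inj₁ lt
        (no ¬lt) → inj₂ (trans (tra-pair i k a)
          (trans (cong (λ p → memberBit p a) (eq k (≮⇒≥ ¬lt))) (sym (tra-pair i _ a))))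

    -- The index is the code of the lasso cut from `t` itself. With `pre-member` this exchanges
    -- quantifiers over `T` for quantifiers over indices of positive preperiod.
    member⁺ : ∀ {t} → T t → ∃[ i ] Member i × tr i ≗ t
    member⁺ {t} t∈T with T-periodic t t∈T
    ... | s , suc q , _ , _ , per = encodeLasso l , (t , t∈T , eq) , eq
      where
      l : Lasso n
      l = s , q , applyUpTo t (s + suc q)
      eq : tr (encodeLasso l) ≗ t
      eq k = trans (cong (λ l → unroll l k) (proj₂ decodeLasso l)) (unroll-fold per k)

    pre-member : ∀ i → 0 < pre i ⇔ Member i
    pre-member i with em {Member i}
    ... | yes m@(t , t∈T , _) = mk⇔ (λ _ → m) (λ _ → let (_ , _ , 0<s , _) = T-periodic t t∈T in 0<s)
    ... | no ¬m = mk⇔ (λ ()) (⊥-elim ∘ ¬m)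

    qf-holds : ∀ {c x} → ⟦_⟧ F qfClause (c ∷ n ∷ x ∷ [])
    qf-holds c e = zero-or λ w → cases (to (relation-pair _ c e) w)
      where
      wqf⁺ : ∀ (ψ : QuantifierFree n) → (∀ π → Occurs π ψ → 0 < val (pair e π)) →
             0 < wqf (pair (encodeQF ψ) e)
      wqf⁺ ψ occ = from (relation-pair _ (encodeQF ψ) e) (ψ , refl , occ)

      cases : (∃ λ (ψ : QuantifierFree n) →
                c ≡ encodeQF ψ × (∀ π → Occurs π ψ → 0 < val (pair e π))) → _
      cases (a ⟨ π ⟩ , refl , occ) = inj₁ (toℕ a , π , refl , toℕ<n a , occ π refl , λ j →
        iff⁻¹ (⇔.trans (tru-pair (qf (a ⟨ π ⟩)) e j) (atom j)))
        where
        atom : ∀ j → (env e [ j ,∞⟩ ⊨qf a ⟨ π ⟩) ⇔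
               (∃[ i ] val (pair e π) ≡ suc i × 0 < tra (pair i (pair j (toℕ a))))
        atom j rewrite val-pair e π with find (bindings e) π
        ... | zero  = mk⇔ (λ ()) (λ ())
        ... | suc i = mk⇔
          (λ { (just a∈) → i , refl , subst (0 <_) (sym (tra-pair i j (toℕ a)))
                 (from (memberBit-∈ (tr i j) a) (subst (λ k → a ∈ tr i k) (+-identityʳ j) a∈)) })
          (λ { (_ , refl , 0<) → just (subst (λ k → a ∈ tr i k) (sym (+-identityʳ j))
                 (to (memberBit-∈ (tr i j) a) (subst (0 <_) (tra-pair i j (toℕ a)) 0<))) })
      cases (¬′ ψ , refl , occ) = inj₂ (inj₁ (encodeQF ψ , refl , wqf⁺ ψ occ , λ j →
        iff⁻¹ (⇔.trans (tru-pair (qf (¬′ ψ)) e j)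
          (mk⇔ (_∘ to (tru-pair (qf ψ) e j)) (_∘ from (tru-pair (qf ψ) e j))))))
      cases (ψ ∨′ χ , refl , occ) = inj₂ (inj₂ (inj₁ (encodeQF ψ , encodeQF χ , refl ,
        wqf⁺ ψ (λ π → occ π ∘ inj₁) , wqf⁺ χ (λ π → occ π ∘ inj₂) , λ j →
        iff⁻¹ (⇔.trans (tru-pair (qf (ψ ∨′ χ)) e j)
          (⇔.sym (tru-pair (qf ψ) e j) ⊎-⇔ ⇔.sym (tru-pair (qf χ) e j))))))
      cases (X ψ , refl , occ) = inj₂ (inj₂ (inj₂ (inj₁ (encodeQF ψ , refl , wqf⁺ ψ occ , λ j →
        iff⁻¹ (⇔.trans (tru-pair (qf (X ψ)) e j) (⇔.trans
          (mk⇔ (⊨qf-cong (shift-+ (env e) j 1) ψ) (⊨qf-cong (≈-sym (shift-+ (env e) j 1)) ψ))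
          (⇔.sym (tru-pair (qf ψ) e (j + 1)))))))))
      cases (ψ U χ , refl , occ) = inj₂ (inj₂ (inj₂ (inj₂ (encodeQF ψ , encodeQF χ , refl ,
        wqf⁺ ψ (λ π → occ π ∘ inj₁) , wqf⁺ χ (λ π → occ π ∘ inj₂) , λ j →
        iff⁻¹ (⇔.trans (tru-pair (qf (ψ U χ)) e j) (mk⇔
          (λ (i , q , p) → i , from (tru-pair (qf χ) e (j + i)) (⊨qf-cong (shift-+ (env e) j i) χ q) ,
            λ i′ → imply em λ lt →
              from (tru-pair (qf ψ) e (j + i′)) (⊨qf-cong (shift-+ (env e) j i′) ψ (p i′ lt)))
          (λ (i , q , p) →
            i , ⊨qf-cong (≈-sym (shift-+ (env e) j i)) χ (to (tru-pair (qf χ) e (j + i)) q) ,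
            λ i′ lt → ⊨qf-cong (≈-sym (shift-+ (env e) j i′)) ψ
              (to (tru-pair (qf ψ) e (j + i′)) (implies (p i′) lt)))))))))

    tru-pair-0 : ∀ (φ : HyperLTL n) e → 0 < tru (pair (encodeFormula φ) (pair e 0)) ⇔ (T , env e ⊨ φ)
    tru-pair-0 φ e = ⇔.trans (tru-pair φ e 0)
      (mk⇔ (⊨-cong (shift-0 (env e)) φ) (⊨-cong (≈-sym (shift-0 (env e))) φ))

    tru-update : ∀ (φ : HyperLTL n) e π i {t} → tr i ≗ t →
      0 < tru (pair (encodeFormula φ) (pair (upd (pair e (pair π i))) 0)) ⇔ (T , env e [ π ↦ t ] ⊨ φ)
    tru-update φ e π i {t} eq rewrite upd-pair e π i = ⇔.trans (tru-pair-0 φ (bind e π i))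
      (mk⇔ (⊨-cong env≈ φ) (⊨-cong (≈-sym env≈) φ))
      where
      env≈ : env (bind e π i) ≈ env e [ π ↦ t ]
      env≈ = ≈-trans (env-bind e π i) (≈-update (λ ρ → Pointwise.refl (λ _ → refl)) eq π)

    formula-holds : ∀ {m} {ρ : Vec ℕ m} → ⟦_⟧ F formulaClause ρ
    formula-holds c e = zero-or λ w → cases (to (relation-pair _ c e) w)
      where
      wff⁺ : ∀ (φ : HyperLTL n) {π} → (∀ ρ → ρ ≢ π × Free ρ φ → 0 < val (pair e ρ)) →
             ∀ i → 0 < wff (pair (encodeFormula φ) (upd (pair e (pair π i))))
      wff⁺ φ {π} free i =
        from (relation-pair _ (encodeFormula φ) (upd (pair e (pair π i)))) (φ , refl , bound)
        where
        bound : ∀ ρ → Free ρ φ → 0 < val (pair (upd (pair e (pair π i))) ρ)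
        bound ρ fr with update-holds {ρ = []} e π i ρ
        ... | inj₁ (_ , eq)   = subst (0 <_) (sym eq) (s≤s z≤n)
        ... | inj₂ (ρ≢π , eq) = subst (0 <_) (sym eq) (free ρ (ρ≢π , fr))

      cases : (∃ λ (φ : HyperLTL n) → c ≡ encodeFormula φ × (∀ π → Free π φ → 0 < val (pair e π))) → _
      cases (qf ψ , refl , occ) = inj₁ (from (relation-pair _ (encodeQF ψ) e) (ψ , refl , occ))
      cases (∃′ π φ , refl , free) = inj₂ (inj₁ (π , encodeFormula φ , refl , wff⁺ φ free ,
        iff⁻¹ (⇔.trans (tru-pair-0 (∃′ π φ) e) (mk⇔
          (λ (t , t∈T , sat) → let (i , mem , eq) = member⁺ t∈T in
             i , from (pre-member i) mem , from (tru-update φ e π i eq) sat)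
          (λ (i , p , tv) → let (t , t∈T , eq) = to (pre-member i) p in
             t , t∈T , to (tru-update φ e π i eq) tv)))))
      cases (∀′ π φ , refl , free) = inj₂ (inj₂ (π , encodeFormula φ , refl , wff⁺ φ free ,
        iff⁻¹ (⇔.trans (tru-pair-0 (∀′ π φ) e) (mk⇔
          (λ sat i → imply em λ p → let (t , t∈T , eq) = to (pre-member i) p in
             from (tru-update φ e π i eq) (sat t t∈T))
          (λ tv t t∈T → let (i , mem , eq) = member⁺ t∈T in
             to (tru-update φ e π i eq) (implies (tv i) (from (pre-member i) mem)))))))

    formula-true : ∀ (φ : HyperLTL n) → Sentence φ → T ⊨ φ → ⟦_⟧ F upFormula [ encode n φ ]
    formula-true φ closed sat = (refl , λ _ → refl) , n , encodeFormula φ , refl ,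
      empty-holds {ρ = []} , update-holds {ρ = []} , period-holds {ρ = []} ,
      qf-holds {encodeFormula φ} {0} , formula-holds {ρ = []} ,
      from (relation-pair _ (encodeFormula φ) 0) (φ , refl , λ π fr → ⊥-elim (closed π fr)) ,
      from (tru-pair-0 φ 0) (⊨-cong (λ π → subst (λ v → Pointwise _≗_ nothing (fromTable tr v))
        (sym (trans (sym (val-pair 0 π)) (empty-holds {ρ = []} π))) nothing) φ sat)

  up-Σ¹₁ : Σ¹₁ UPSatisfiability
  up-Σ¹₁ = 8 , upFormula , λ x → mk⇔
    (λ { (n , φ , refl , closed , T , T-per , sat) →
         Completeness.F T T-per , Completeness.formula-true T T-per φ closed sat })
    (up-sound x)

-- Relations as sets of traces

∃-⇔ : {P R : A → Set} → (∀ a → P a ⇔ R a) → ∃ P ⇔ ∃ R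
∃-⇔ e = mk⇔ (map₂ (to (e _))) (map₂ (from (e _)))

≡⇒⇔ : A ≡ B → A ⇔ B
≡⇒⇔ refl = ⇔.refl

¬-⇔ : A ⇔ B → (¬ A) ⇔ (¬ B)
¬-⇔ e = mk⇔ (_∘ from e) (_∘ to e)

-- Recursive functions that build codes

Computes : Recursive n → (Vec ℕ n → ℕ) → Set
Computes e f = ∀ xs → e · xs ⇓ f xs

constᶠ : ℕ → Recursive n
constᶠ zero    = zeroᶠ
constᶠ (suc c) = comp sucᶠ [ constᶠ c ]

constᶠ-computes : ∀ c → Computes {n} (constᶠ c) (λ _ → c)
constᶠ-computes zero    xs = zero⇓
constᶠ-computes (suc c) xs = comp⇓ (constᶠ-computes c xs ∷ []) suc⇓

addᶠ : Recursive 2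
addᶠ = prec (proj 0F) (comp sucᶠ [ proj 1F ])

addᶠ-computes : ∀ a b → addᶠ · a ∷ b ∷ [] ⇓ a + b
addᶠ-computes zero    b = prec-zero⇓ proj⇓
addᶠ-computes (suc a) b = prec-suc⇓ (addᶠ-computes a b) (comp⇓ (proj⇓ ∷ []) suc⇓)

triangleᶠ : Recursive 1
triangleᶠ = prec zeroᶠ (comp sucᶠ [ comp addᶠ (proj 0F ∷ proj 1F ∷ []) ])

triangleᶠ-computes : ∀ a → triangleᶠ · [ a ] ⇓ triangle a
triangleᶠ-computes zero    = prec-zero⇓ zero⇓
triangleᶠ-computes (suc a) = prec-suc⇓ (triangleᶠ-computes a)
  (comp⇓ (comp⇓ (proj⇓ ∷ proj⇓ ∷ []) (addᶠ-computes a (triangle a)) ∷ []) suc⇓)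

pairᶠ : Recursive n → Recursive n → Recursive n
pairᶠ e d = comp addᶠ (comp triangleᶠ [ comp addᶠ (e ∷ d ∷ []) ] ∷ d ∷ [])

pairᶠ-computes : ∀ {e d : Recursive n} {xs a b} → e · xs ⇓ a → d · xs ⇓ b → pairᶠ e d · xs ⇓ pair a b
pairᶠ-computes {a = a} {b} p q = comp⇓
  (comp⇓ (comp⇓ (p ∷ q ∷ []) (addᶠ-computes a b) ∷ []) (triangleᶠ-computes (a + b)) ∷ q ∷ [])
  (addᶠ-computes (triangle (a + b)) b)

const-computable : ∀ c → Computable (λ _ → c)
const-computable c = constᶠ c , λ x → constᶠ-computes c [ x ]

pair-computable : ∀ {f g} → Computable f → Computable g → Computable (λ x → pair (f x) (g x))
pair-computable (e , p) (d , q) = pairᶠ e d , λ x → pairᶠ-computes (p x) (q x)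

-- Records keep the type checker from comparing nested applications of pair by
-- unfolding them.
record ComputableQF (ψ : ℕ → QuantifierFree n) : Set where
  field computableQF : Computable (λ x → encodeQF (ψ x))

record ComputableFormula (φ : ℕ → HyperLTL n) : Set where
  field computableFormula : Computable (λ x → encodeFormula (φ x))

open ComputableQF
open ComputableFormula

-- Derived connectives and blocks of existential quantifiers

infix  24 ◇_
infixl 23 _∧′_
_∧′_ : QuantifierFree n → QuantifierFree n → QuantifierFree n
ψ ∧′ χ = ¬′ (¬′ ψ ∨′ ¬′ χ)

-- The grammar has no constants, so truth is an instance of excluded middle for some atom. Trace
-- variable 0 is chosen because the final sentence binds it outermost and thus stays closed.
⊤′ : QuantifierFree (suc n)
⊤′ = 0F ⟨ 0 ⟩ ∨′ ¬′ 0F ⟨ 0 ⟩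

◇_ : QuantifierFree (suc n) → QuantifierFree (suc n)
◇ ψ = ⊤′ U ψ

next : ℕ → QuantifierFree n → QuantifierFree n
next zero    ψ = ψ
next (suc k) ψ = X next k ψ

⋀ : ∀ N → (Fin N → QuantifierFree (suc n)) → QuantifierFree (suc n)
⋀ zero    ψ = ⊤′
⋀ (suc N) ψ = ψ zero ∧′ ⋀ N (ψ ∘ suc)

exists : Var → ℕ → QuantifierFree n → HyperLTL n
exists s zero    ψ = qf ψ
exists s (suc N) ψ = ∃′ s (exists (suc s) N ψ)

extend : Assignment n → Var → ∀ N → (Fin N → Trace n) → Assignment n
extend Π s zero    ts = Π
extend Π s (suc N) ts = extend (Π [ s ↦ ts zero ]) (suc s) N (ts ∘ suc)

exists-sat : ∀ {T : Trace n → Set} N {Π s} ψ →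
  (T , Π ⊨ exists s N ψ) ⇔ (∃ λ (ts : Fin N → Trace n) → (∀ i → T (ts i)) × extend Π s N ts ⊨qf ψ)
exists-sat zero    ψ = mk⇔ (λ sat → (λ ()) , (λ ()) , sat) (λ (_ , _ , sat) → sat)
exists-sat {n} {T} (suc N) ψ = mk⇔
  (λ (t , t∈T , sat) → let (ts , ts∈T , sat′) = to (exists-sat N ψ) sat in
     cons t ts , cons-in t∈T ts∈T , sat′)
  (λ (ts , ts∈T , sat) → ts zero , ts∈T zero , from (exists-sat N ψ) (ts ∘ suc , ts∈T ∘ suc , sat))
  where
  cons : Trace n → (Fin N → Trace n) → Fin (suc N) → Trace n
  cons t ts zero    = t
  cons t ts (suc i) = ts i
  cons-in : ∀ {t ts} → T t → (∀ i → T (ts i)) → ∀ i → T (cons t ts i)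
  cons-in t∈T ts∈T zero    = t∈T
  cons-in t∈T ts∈T (suc i) = ts∈T i

extend-below : ∀ N (Π : Assignment n) {s} ts {π} → π < s → extend Π s N ts π ≡ Π π
extend-below zero    Π     ts π<s = refl
extend-below (suc N) Π {s} ts π<s =
  trans (extend-below N _ (ts ∘ suc) (m<n⇒m<1+n π<s)) (update-miss Π (ts zero) (<⇒≢ π<s))

extend-at : ∀ {N} (Π : Assignment n) s ts (i : Fin N) → extend Π s N ts (s + toℕ i) ≡ just (ts i)
extend-at {N = suc N} Π s ts zero rewrite +-identityʳ s =
  trans (extend-below N _ (ts ∘ suc) (n<1+n s)) (update-hit Π s (ts zero))
extend-at {N = suc N} Π s ts (suc i) rewrite +-suc s (toℕ i) = extend-at _ (suc s) (ts ∘ suc) i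

-- A tuple stands for the trace on which proposition c holds exactly at
-- position lookup v c.
Tuple : Set
Tuple = Vec ℕ 5

Encodes : Trace 5 → Tuple → Set
Encodes t v = ∀ c k → c ∈ t k ⇔ lookup v c ≡ k

traceOf : Tuple → Trace 5
traceOf v k = tabulate (λ c → does (lookup v c ≟ k))

traceOf-encodes : ∀ v → Encodes (traceOf v) v
traceOf-encodes v c k = ⇔.trans (∈-tabulate {f = λ c → does (lookup v c ≟ k)}) (does⇔ (lookup v c ≟ k))

lookup≤sum : ∀ (v : Vec ℕ n) i → lookup v i ≤ Vec.sum v
lookup≤sum (x ∷ v) zero    = m≤m+n x _
lookup≤sum (x ∷ v) (suc i) = ≤-trans (lookup≤sum v i) (m≤n+m _ x)

traceOf-periodic : ∀ v → UltimatelyPeriodic (traceOf v)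
-- The sum of the entries bounds each of them. Past it no proposition holds, so the trace is
-- constant there and has period 1.
traceOf-periodic v = suc (Vec.sum v) , 1 , s≤s z≤n , s≤s z≤n , λ k sum<k →
  tabulate-cong λ c → trans (past k c sum<k) (sym (past (k + 1) c (≤-trans sum<k (m≤m+n k 1))))
  where
  past : ∀ k c → Vec.sum v < k → does (lookup v c ≟ k) ≡ false
  past k c sum<k = dec-false (lookup v c ≟ k) (<⇒≢ (≤-<-trans (lookup≤sum v c) sum<k))

-- Entry (p , c) is column c of the p-th of three tuples.
Entry : Set
Entry = Fin 3 × Fin 5

infix 6 _≐_ _⋖_ _≺_ _≐#_
infix 5 ∼_
infixr 4 _&_
infixr 3 _∥_

data Constraint : Set where
  _≐_ _⋖_ _≺_ : Entry → Entry → Constraint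
  _≐#_        : Entry → ℕ → Constraint
  ∼_          : Constraint → Constraint
  _&_ _∥_     : Constraint → Constraint → Constraint

entry : Vec Tuple 3 → Entry → ℕ
entry vs (p , c) = lookup (lookup vs p) c

⟦_⟧ᶜ : Constraint → Vec Tuple 3 → Set
⟦ x ≐ y ⟧ᶜ  vs = entry vs x ≡ entry vs y
⟦ x ⋖ y ⟧ᶜ  vs = suc (entry vs x) ≡ entry vs y
⟦ x ≺ y ⟧ᶜ  vs = entry vs x < entry vs y
⟦ x ≐# k ⟧ᶜ vs = entry vs x ≡ k
⟦ ∼ C ⟧ᶜ    vs = ¬ ⟦ C ⟧ᶜ vs
⟦ C & D ⟧ᶜ  vs = ⟦ C ⟧ᶜ vs × ⟦ D ⟧ᶜ vs
⟦ C ∥ D ⟧ᶜ  vs = ⟦ C ⟧ᶜ vs ⊎ ⟦ D ⟧ᶜ vs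

module Compile (σ : Vec Var 3) where

  at : Entry → QuantifierFree 5
  at (p , c) = c ⟨ lookup σ p ⟩

  -- On traces that code tuples each proposition occurs once. Hence equality of entries is a
  -- simultaneous occurrence, and successor and order are occurrences one step later and strictly
  -- later.
  compile : Constraint → QuantifierFree 5
  compile (x ≐ y)  = ◇ (at x ∧′ at y)
  compile (x ⋖ y)  = ◇ (at x ∧′ X at y)
  compile (x ≺ y)  = ◇ (at x ∧′ X ◇ at y)
  compile (x ≐# k) = next k (at x)
  compile (∼ C)    = ¬′ compile C
  compile (C & D)  = compile C ∧′ compile D
  compile (C ∥ D)  = compile C ∨′ compile D

once : Var → Fin 5 → QuantifierFree 5
once π c = ◇ c ⟨ π ⟩ ∧′ ¬′ ◇ (c ⟨ π ⟩ ∧′ X ◇ c ⟨ π ⟩)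

-- Closedness and computability of the sentences

Below : ℕ → QuantifierFree n → Set
Below N ψ = ∀ π → Occurs π ψ → π < N

∧′-below : ∀ {N} {ψ χ : QuantifierFree n} → Below N ψ → Below N χ → Below N (ψ ∧′ χ)
∧′-below p q π = [ p π , q π ]′

⊤′-below : ∀ {N} → Below {suc n} (suc N) ⊤′
⊤′-below π (inj₁ refl) = s≤s z≤n
⊤′-below π (inj₂ refl) = s≤s z≤n

◇-below : ∀ {N} {ψ : QuantifierFree (suc n)} → Below (suc N) ψ → Below (suc N) (◇ ψ)
◇-below {n} p π = [ ⊤′-below {n} π , p π ]′

next-below : ∀ {N} k {ψ : QuantifierFree n} → Below N ψ → Below N (next k ψ)
next-below zero    p = p
next-below (suc k) p = next-below k p

⋀-below : ∀ {N} M {ψ : Fin M → QuantifierFree (suc n)} → (∀ i → Below (suc N) (ψ i)) →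
          Below (suc N) (⋀ M ψ)
⋀-below {n} zero    p = ⊤′-below {n}
⋀-below (suc M) {ψ} p = ∧′-below {ψ = ψ zero} {⋀ M (ψ ∘ suc)} (p zero) (⋀-below M {ψ ∘ suc} (p ∘ suc))

atom-below : ∀ {N π} {c : Fin n} → π < N → Below N (c ⟨ π ⟩)
atom-below π<N _ refl = π<N

compile-below : ∀ {N} {σ : Vec Var 3} → (∀ p → lookup σ p < suc N) →
                ∀ C → Below (suc N) (Compile.compile σ C)
compile-below {σ = σ} σ< = below
  where
  open Compile σ
  at-below : ∀ x → Below _ (at x)
  at-below (p , c) = atom-below {c = c} (σ< p)

  below : ∀ C → Below _ (compile C)
  below (x ≐ y) = ◇-below {ψ = at x ∧′ at y} (∧′-below {ψ = at x} {at y} (at-below x) (at-below y))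
  below (x ⋖ y) = ◇-below {ψ = at x ∧′ X at y} (∧′-below {ψ = at x} {X at y} (at-below x) (at-below y))
  below (x ≺ y) = ◇-below {ψ = at x ∧′ X ◇ at y}
    (∧′-below {ψ = at x} {X ◇ at y} (at-below x) (◇-below {ψ = at y} (at-below y)))
  below (x ≐# k) = next-below k {at x} (at-below x)
  below (∼ C)   = below C
  below (C & D) = ∧′-below {ψ = compile C} {compile D} (below C) (below D)
  below (C ∥ D) π = [ below C π , below D π ]′

exists-free : ∀ N {s} {ψ : QuantifierFree n} → Below (s + N) ψ → ∀ {π} → Free π (exists s N ψ) → π < s
exists-free zero    {s} below {π} fr = subst (π <_) (+-identityʳ s) (below π fr)
exists-free (suc N) {s} {ψ} below {π} (π≢s , fr) =
  ≤∧≢⇒< (s≤s⁻¹ (exists-free N (subst (λ b → Below b ψ) (+-suc s N) below) fr)) π≢s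

quantifier-computable : ∀ k π {φ : ℕ → HyperLTL n} → ComputableFormula φ →
                        Computable (λ x → pair k (pair π (encodeFormula (φ x))))
quantifier-computable k π c =
  pair-computable (const-computable k) (pair-computable (const-computable π) (computableFormula c))

∃′-computable : ∀ π {φ : ℕ → HyperLTL n} → ComputableFormula φ → ComputableFormula (λ x → ∃′ π (φ x))
∃′-computable π c .computableFormula = quantifier-computable 5 π c

∀′-computable : ∀ π {φ : ℕ → HyperLTL n} → ComputableFormula φ → ComputableFormula (λ x → ∀′ π (φ x))
∀′-computable π c .computableFormula = quantifier-computable 6 π c

exists-computable : ∀ N {s} {ψ : ℕ → QuantifierFree n} → ComputableQF ψ →
                    ComputableFormula (λ x → exists s N (ψ x))
exists-computable zero    c .computableFormula = computableQF c
exists-computable (suc N) {s} c = ∃′-computable s (exists-computable N c)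

¬′-computable : ∀ {ψ : ℕ → QuantifierFree n} → ComputableQF ψ → ComputableQF (λ x → ¬′ ψ x)
¬′-computable c .computableQF = pair-computable (const-computable 1) (computableQF c)

∨′-computable : ∀ {ψ χ : ℕ → QuantifierFree n} → ComputableQF ψ → ComputableQF χ →
                ComputableQF (λ x → ψ x ∨′ χ x)
∨′-computable p q .computableQF =
  pair-computable (const-computable 2) (pair-computable (computableQF p) (computableQF q))

∧′-computable : ∀ {ψ χ : ℕ → QuantifierFree n} → ComputableQF ψ → ComputableQF χ →
                ComputableQF (λ x → ψ x ∧′ χ x)
∧′-computable p q = ¬′-computable (∨′-computable (¬′-computable p) (¬′-computable q))

fixed-computable : (ψ : QuantifierFree n) → ComputableQF (λ _ → ψ)
fixed-computable ψ .computableQF = const-computable (encodeQF ψ)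

-- The input of the reduction enters its output only through this number of `X` operators, produced
-- by primitive recursion; the rest of the sentence is constant.
next-computable : (ψ : QuantifierFree n) → ComputableQF (λ k → next k ψ)
next-computable {n} ψ .computableQF = prec (constᶠ (encodeQF ψ)) step , computes
  where
  step : Recursive 2
  step = pairᶠ (constᶠ 3) (proj 1F)

  computes : ∀ k → prec (constᶠ (encodeQF ψ)) step · [ k ] ⇓ encodeQF (next k ψ)
  computes zero    = prec-zero⇓ (constᶠ-computes _ [])
  computes (suc k) = prec-suc⇓ (computes k)
    (pairᶠ-computes {e = constᶠ 3} {proj 1F} (constᶠ-computes 3 (k ∷ encodeQF (next k ψ) ∷ [])) proj⇓)

-- `UPSatisfiability` speaks of some formula with the given code; injectivity of `encode` identifies
-- it with `φ x`.
formula-reduction : {S : ℕ → Set₁} {φ : ℕ → HyperLTL n} → ComputableFormula φ → (∀ x → Sentence (φ x)) →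
                    (∀ x → S x ⇔ UPSatisfiable (φ x)) → S ≤ₘ UPSatisfiability
formula-reduction {n} {S} {φ} computable closed S⇔ =
  (λ x → encode n (φ x)) ,
  pair-computable (const-computable n) (computableFormula computable) , λ x → mk⇔
    (λ s → n , φ x , refl , closed x , to (S⇔ x) s)
    (λ (_ , χ , eq , _ , sat) → from (S⇔ x) (transport (encode-injective (φ x) χ eq) sat))
  where
  transport : ∀ {m} {χ : HyperLTL m} {φ : HyperLTL n} → (n , φ) ≡ (∃ HyperLTL ∋ (m , χ)) →
              UPSatisfiable χ → UPSatisfiable φ
  transport refl sat = sat

-- Semantics of the derived operators and of constraints

module _ (em : ExcludedMiddle 0ℓ) where

  ∧′-sat : ∀ (Π : Assignment n) ψ χ → (Π ⊨qf ψ ∧′ χ) ⇔ (Π ⊨qf ψ × Π ⊨qf χ)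
  ∧′-sat Π ψ χ = mk⇔
    (λ h → decidable-stable em (h ∘ inj₁) , decidable-stable em (h ∘ inj₂))
    (λ (p , q) → [ (λ ¬p → ¬p p) , (λ ¬q → ¬q q) ]′)

  ⊤′-sat : (Π : Assignment (suc n)) → Π ⊨qf ⊤′
  ⊤′-sat Π = case em {Π ⊨qf 0F ⟨ 0 ⟩} of λ where
    (yes p) → inj₁ p
    (no ¬p) → inj₂ ¬p

  ◇-sat : ∀ (Π : Assignment (suc n)) ψ → (Π ⊨qf ◇ ψ) ⇔ (∃[ j ] Π [ j ,∞⟩ ⊨qf ψ)
  ◇-sat Π ψ = mk⇔ (λ (j , p , _) → j , p) (λ (j , p) → j , p , λ i _ → ⊤′-sat (Π [ i ,∞⟩))

  ⋀-sat : ∀ (Π : Assignment (suc n)) N ψ → (Π ⊨qf ⋀ N ψ) ⇔ (∀ i → Π ⊨qf ψ i)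
  ⋀-sat Π zero    ψ = mk⇔ (λ _ ()) (λ _ → ⊤′-sat Π)
  ⋀-sat Π (suc N) ψ = ⇔.trans (∧′-sat Π (ψ zero) (⋀ N (ψ ∘ suc))) (mk⇔
    (λ { (p , q) zero → p ; (p , q) (suc i) → to (⋀-sat Π N (ψ ∘ suc)) q i })
    (λ h → h zero , from (⋀-sat Π N (ψ ∘ suc)) (h ∘ suc)))

  atom-sat : ∀ (Π : Assignment (suc n)) {π t} → Π π ≡ just t → ∀ c i → (Π [ i ,∞⟩ ⊨qf c ⟨ π ⟩) ⇔ c ∈ t i
  atom-sat Π {t = t} eq c i rewrite eq =
    ⇔.trans (⇔.sym Any.just-equivalence) (≡⇒⇔ (cong (λ k → c ∈ t k) (+-identityʳ i)))

  module Atoms {Π : Assignment (suc n)} {π ρ t u} (Ππ : Π π ≡ just t) (Πρ : Π ρ ≡ just u)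
               (c d : Fin (suc n)) where

    shifts : ∀ i j ψ → (Π [ i ,∞⟩ [ j ,∞⟩ ⊨qf ψ) ⇔ (Π [ i + j ,∞⟩ ⊨qf ψ)
    shifts i j ψ = mk⇔ (⊨qf-cong (shift-+ Π i j) ψ) (⊨qf-cong (≈-sym (shift-+ Π i j)) ψ)

    meet-sat : (Π ⊨qf ◇ (c ⟨ π ⟩ ∧′ d ⟨ ρ ⟩)) ⇔ (∃[ i ] c ∈ t i × d ∈ u i)
    meet-sat = ⇔.trans (◇-sat Π (c ⟨ π ⟩ ∧′ d ⟨ ρ ⟩)) (∃-⇔ λ i →
      ⇔.trans (∧′-sat (Π [ i ,∞⟩) (c ⟨ π ⟩) (d ⟨ ρ ⟩)) (atom-sat Π Ππ c i ×-⇔ atom-sat Π Πρ d i))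

    step-sat : (Π ⊨qf ◇ (c ⟨ π ⟩ ∧′ X d ⟨ ρ ⟩)) ⇔ (∃[ i ] c ∈ t i × d ∈ u (i + 1))
    step-sat = ⇔.trans (◇-sat Π (c ⟨ π ⟩ ∧′ X d ⟨ ρ ⟩)) (∃-⇔ λ i →
      ⇔.trans (∧′-sat (Π [ i ,∞⟩) (c ⟨ π ⟩) (X d ⟨ ρ ⟩))
        (atom-sat Π Ππ c i ×-⇔ ⇔.trans (shifts i 1 (d ⟨ ρ ⟩)) (atom-sat Π Πρ d (i + 1))))

    before-sat : (Π ⊨qf ◇ (c ⟨ π ⟩ ∧′ X ◇ d ⟨ ρ ⟩)) ⇔ (∃[ i ] c ∈ t i × ∃[ j ] d ∈ u (i + 1 + j))
    before-sat = ⇔.trans (◇-sat Π (c ⟨ π ⟩ ∧′ X ◇ d ⟨ ρ ⟩)) (∃-⇔ λ i →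
      ⇔.trans (∧′-sat (Π [ i ,∞⟩) (c ⟨ π ⟩) (X ◇ d ⟨ ρ ⟩))
        (atom-sat Π Ππ c i ×-⇔
         ⇔.trans (shifts i 1 (◇ d ⟨ ρ ⟩)) (⇔.trans (◇-sat (Π [ i + 1 ,∞⟩) (d ⟨ ρ ⟩))
          (∃-⇔ λ j → ⇔.trans (shifts (i + 1) j (d ⟨ ρ ⟩)) (atom-sat Π Πρ d (i + 1 + j))))))

    next-sat : ∀ k → (Π ⊨qf next k (c ⟨ π ⟩)) ⇔ c ∈ t k
    next-sat k = ⇔.trans (mk⇔ (⊨qf-cong (≈-sym (shift-0 Π)) ψ) (⊨qf-cong (shift-0 Π) ψ)) (from-pos 0 k)
      where
      ψ : QuantifierFree (suc n)
      ψ = next k (c ⟨ π ⟩)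

      from-pos : ∀ i k → (Π [ i ,∞⟩ ⊨qf next k (c ⟨ π ⟩)) ⇔ c ∈ t (i + k)
      from-pos i zero    =
        ⇔.trans (atom-sat Π Ππ c i) (≡⇒⇔ (cong (λ k → c ∈ t k) (sym (+-identityʳ i))))
      from-pos i (suc k) = ⇔.trans (shifts i 1 (next k (c ⟨ π ⟩))) (⇔.trans (from-pos (i + 1) k)
        (≡⇒⇔ (cong (λ k → c ∈ t k) (+-assoc i 1 k))))

  once-sat : ∀ {Π : Assignment 5} {π t} → Π π ≡ just t → ∀ c →
    (Π ⊨qf once π c) ⇔ ((∃[ k ] c ∈ t k) × ¬ (∃[ i ] c ∈ t i × ∃[ j ] c ∈ t (i + 1 + j)))
  once-sat {Π} {π} eq c =
    ⇔.trans (∧′-sat Π (◇ c ⟨ π ⟩) (¬′ ◇ (c ⟨ π ⟩ ∧′ X ◇ c ⟨ π ⟩)))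
      (⇔.trans (◇-sat Π (c ⟨ π ⟩)) (∃-⇔ (atom-sat Π eq c)) ×-⇔ ¬-⇔ before-sat)
    where open Atoms {Π = Π} eq eq c c

  -- Two distinct occurrences would be ordered, which `once` forbids. Imposed on a universally
  -- quantified trace, this makes every trace of a model code a tuple.
  once-encodes : ∀ {Π : Assignment 5} {π t} → Π π ≡ just t →
    (∀ c → Π ⊨qf once π c) ⇔ (∃[ v ] Encodes t v)
  once-encodes {Π} {π} {t} eq = mk⇔
    (λ h → let g = λ c → to (once-sat {Π} eq c) (h c) in
       tabulate (λ c → proj₁ (proj₁ (g c))) , encodes g)
    (λ (v , enc) c → from (once-sat {Π} eq c) ((_ , from (enc c _) refl) , λ (i , p , j , q) →
      <⇒≢ (i<i+1+j i j) (trans (sym (to (enc c i) p)) (to (enc c _) q))))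
    where
    i<i+1+j : ∀ i j → i < i + 1 + j
    i<i+1+j i j = ≤-trans (≤-reflexive (+-comm 1 i)) (m≤m+n (i + 1) j)

    later : ∀ {c i k} → i < k → c ∈ t k → ∃[ j ] c ∈ t (i + 1 + j)
    later {c} {i} {k} i<k p = k ∸ (i + 1) ,
      subst (λ k → c ∈ t k) (sym (m+[n∸m]≡n (≤-trans (≤-reflexive (+-comm i 1)) i<k))) p

    unique : ∀ {c i k} → ¬ (∃[ i ] c ∈ t i × ∃[ j ] c ∈ t (i + 1 + j)) → c ∈ t i → c ∈ t k → i ≡ k
    unique {c} {i} {k} ¬later p q with <-cmp i k
    ... | tri< lt _ _ = ⊥-elim (¬later (i , p , later lt q))
    ... | tri≈ _ eq _ = eq
    ... | tri> _ _ gt = ⊥-elim (¬later (k , q , later gt p))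

    encodes : (h : ∀ c → (∃[ k ] c ∈ t k) × ¬ (∃[ i ] c ∈ t i × ∃[ j ] c ∈ t (i + 1 + j))) →
              Encodes t (tabulate (λ c → proj₁ (proj₁ (h c))))
    encodes h c k = let ((l , p) , ¬later) = h c in mk⇔
      (λ q → trans (lookup∘tabulate (λ c → proj₁ (proj₁ (h c))) c) (unique ¬later p q))
      (λ eq → subst (λ k → c ∈ t k) (trans (sym (lookup∘tabulate (λ c → proj₁ (proj₁ (h c))) c)) eq) p)

  module _ (σ : Vec Var 3) {Π : Assignment 5} {ts : Fin 3 → Trace 5} {vs : Vec Tuple 3}
           (Πσ : ∀ p → Π (lookup σ p) ≡ just (ts p)) (enc : ∀ p → Encodes (ts p) (lookup vs p)) where
    open Compile σ

    compile-sat : ∀ C → (Π ⊨qf compile C) ⇔ ⟦ C ⟧ᶜ vs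
    compile-sat ((p , c) ≐ (q , d)) = ⇔.trans (Atoms.meet-sat {Π = Π} (Πσ p) (Πσ q) c d) (mk⇔
      (λ (i , x , y) → trans (to (enc p c i) x) (sym (to (enc q d i) y)))
      (λ eq → _ , from (enc p c _) eq , from (enc q d _) refl))
    compile-sat ((p , c) ⋖ (q , d)) = ⇔.trans (Atoms.step-sat {Π = Π} (Πσ p) (Πσ q) c d) (mk⇔
      (λ (i , x , y) →
        trans (cong suc (to (enc p c i) x)) (trans (+-comm 1 i) (sym (to (enc q d (i + 1)) y))))
      (λ eq → _ , from (enc p c _) refl , from (enc q d _) (trans (sym eq) (+-comm 1 _))))
    compile-sat ((p , c) ≺ (q , d)) = ⇔.trans (Atoms.before-sat {Π = Π} (Πσ p) (Πσ q) c d) (mk⇔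
      (λ (i , x , j , y) → subst₂ _<_ (sym (to (enc p c i) x)) (sym (to (enc q d (i + 1 + j)) y))
         (≤-trans (≤-reflexive (+-comm 1 i)) (m≤m+n (i + 1) j)))
      (λ lt → _ , from (enc p c _) refl , _ , from (enc q d _)
         (sym (m+[n∸m]≡n (≤-trans (≤-reflexive (+-comm _ 1)) lt)))))
    compile-sat ((p , c) ≐# k) = ⇔.trans (Atoms.next-sat {Π = Π} (Πσ p) (Πσ p) c c k) (enc p c k)
    compile-sat (∼ C)   = ¬-⇔ (compile-sat C)
    compile-sat (C & D) = ⇔.trans (∧′-sat Π (compile C) (compile D)) (compile-sat C ×-⇔ compile-sat D)
    compile-sat (C ∥ D) = compile-sat C ⊎-⇔ compile-sat D

  -- The sentence describing a closed relation

  module TupleLogic (start N : ℕ) (axioms : Fin N → Constraint) where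

    -- All axioms share the two universal traces, but each has its own existential trace, so the
    -- axioms are witnessed independently.
    vars : Fin N → Vec Var 3
    vars i = 1 ∷ 2 ∷ 3 + toℕ i ∷ []

    axiom : Fin N → QuantifierFree 5
    axiom i = Compile.compile (vars i) (axioms i)

    -- Prenex form places the conditions on trace 0 beneath the universal quantifiers; they are
    -- recovered by instantiating both of these with trace 0 itself. Requiring the shape of a tuple
    -- of variable 1 alone reaches every trace, since that variable is universal.
    constraints : QuantifierFree 5
    constraints = next start (0F ⟨ 0 ⟩) ∧′ (⋀ 5 (once 1) ∧′ ⋀ N axiom)

    matrix : ℕ → QuantifierFree 5
    matrix x = next x (4F ⟨ 0 ⟩) ∧′ constraints

    formula : ℕ → HyperLTL 5
    formula x = ∃′ 0 (∀′ 1 (∀′ 2 (exists 3 N (matrix x))))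

    formula-computable : ComputableFormula formula
    formula-computable = ∃′-computable 0 (∀′-computable 1 (∀′-computable 2
      (exists-computable N
        (∧′-computable (next-computable (4F ⟨ 0 ⟩)) (fixed-computable constraints)))))

    formula-closed : ∀ x → Sentence (formula x)
    formula-closed x π (π≢0 , π≢1 , π≢2 , fr) with exists-free N {3} {matrix x} matrix-below fr
      where
      once-below : ∀ c → Below (3 + N) (once 1 c)
      once-below c π (inj₁ (inj₁ (inj₁ refl))) = s≤s z≤n
      once-below c π (inj₁ (inj₁ (inj₂ refl))) = s≤s z≤n
      once-below c π (inj₁ (inj₂ refl)) = s≤s (s≤s z≤n)
      once-below c π (inj₂ (inj₁ (inj₁ refl))) = s≤s z≤n
      once-below c π (inj₂ (inj₁ (inj₂ refl))) = s≤s z≤n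
      once-below c π (inj₂ (inj₂ (inj₁ refl))) = s≤s (s≤s z≤n)
      once-below c π (inj₂ (inj₂ (inj₂ (inj₁ (inj₁ refl))))) = s≤s z≤n
      once-below c π (inj₂ (inj₂ (inj₂ (inj₁ (inj₂ refl))))) = s≤s z≤n
      once-below c π (inj₂ (inj₂ (inj₂ (inj₂ refl)))) = s≤s (s≤s z≤n)

      vars-below : ∀ i p → lookup (vars i) p < 3 + N
      vars-below i 0F = s≤s (s≤s z≤n)
      vars-below i 1F = s≤s (s≤s (s≤s z≤n))
      vars-below i 2F = +-monoʳ-< 3 (toℕ<n i)

      matrix-below : Below (3 + N) (matrix x)
      matrix-below =
        ∧′-below {ψ = next x (4F ⟨ 0 ⟩)} {constraints}
          (next-below x {4F ⟨ 0 ⟩} (atom-below {c = Fin 5 ∋ 4F} (s≤s z≤n)))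
        (∧′-below {ψ = next start (0F ⟨ 0 ⟩)} {⋀ 5 (once 1) ∧′ ⋀ N axiom}
          (next-below start {0F ⟨ 0 ⟩} (atom-below {c = Fin 5 ∋ 0F} (s≤s z≤n)))
        (∧′-below {ψ = ⋀ 5 (once 1)} {⋀ N axiom} (⋀-below 5 {once 1} once-below)
          (⋀-below N {axiom} λ i → compile-below (vars-below i) (axioms i))))
    ... | s≤s z≤n             = π≢0 refl
    ... | s≤s (s≤s z≤n)       = π≢1 refl
    ... | s≤s (s≤s (s≤s z≤n)) = π≢2 refl

    Model : (Tuple → Set) → ℕ → Set
    Model R x = (∃[ v ] R v × lookup v 4F ≡ x × lookup v 0F ≡ start) ×
      (∀ u v → R u → R v → ∀ i → ∃[ w ] R w × ⟦ axioms i ⟧ᶜ (u ∷ v ∷ w ∷ []))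

    module _ (t₀ t₁ t₂ : Trace 5) (ts : Fin N → Trace 5) where

      Π : Assignment 5
      Π = extend (Π∅ [ 0 ↦ t₀ ] [ 1 ↦ t₁ ] [ 2 ↦ t₂ ]) 3 N ts

      Π-0 : Π 0 ≡ just t₀
      Π-0 = extend-below N _ ts (s≤s z≤n)
      Π-1 : Π 1 ≡ just t₁
      Π-1 = extend-below N _ ts (s≤s (s≤s z≤n))

      traces : Fin N → Fin 3 → Trace 5
      traces i 0F = t₁
      traces i 1F = t₂
      traces i 2F = ts i

      Π-vars : ∀ i p → Π (lookup (vars i) p) ≡ just (traces i p)
      Π-vars i 0F = Π-1
      Π-vars i 1F = extend-below N _ ts (s≤s (s≤s (s≤s z≤n)))
      Π-vars i 2F = extend-at _ 3 ts i

      matrix-sat : ∀ x → (Π ⊨qf matrix x) ⇔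
        (4F ∈ t₀ x × 0F ∈ t₀ start × (∃[ v ] Encodes t₁ v) × (∀ i → Π ⊨qf axiom i))
      matrix-sat x =
        ⇔.trans (∧′-sat Π (next x (4F ⟨ 0 ⟩)) constraints)
          (Atoms.next-sat {Π = Π} Π-0 Π-0 4F 4F x ×-⇔
        ⇔.trans (∧′-sat Π (next start (0F ⟨ 0 ⟩)) (⋀ 5 (once 1) ∧′ ⋀ N axiom))
          (Atoms.next-sat {Π = Π} Π-0 Π-0 0F 0F start ×-⇔
        ⇔.trans (∧′-sat Π (⋀ 5 (once 1)) (⋀ N axiom))
          (⇔.trans (⋀-sat Π 5 (once 1)) (once-encodes {Π} Π-1) ×-⇔ ⋀-sat Π N axiom)))

    formula-sat : ∀ x → UPSatisfiable (formula x) ⇔ (∃ λ (R : Tuple → Set) → Model R x)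
    formula-sat x = mk⇔ toModel fromModel
      where
      toModel : UPSatisfiable (formula x) → ∃ λ (R : Tuple → Set) → Model R x
      toModel (T , _ , t₀ , t₀∈T , sat) = R , root , laws
        where
        R : Tuple → Set
        R v = ∃[ t ] T t × Encodes t v

        satᵐ : ∀ {t₁ t₂} → T t₁ → T t₂ → ∃ λ (ts : Fin N → Trace 5) → (∀ i → T (ts i)) ×
          4F ∈ t₀ x × 0F ∈ t₀ start × (∃[ v ] Encodes t₁ v) × (∀ i → Π t₀ t₁ t₂ ts ⊨qf axiom i)
        satᵐ {t₁} {t₂} t₁∈T t₂∈T =
          let (ts , ts∈T , s) = to (exists-sat N (matrix x)) (sat t₁ t₁∈T t₂ t₂∈T)
          in ts , ts∈T , to (matrix-sat t₀ t₁ t₂ ts x) s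

        encoded : ∀ {t} → T t → ∃[ v ] Encodes t v
        encoded t∈T = let (_ , _ , _ , _ , enc , _) = satᵐ t∈T t∈T in enc

        root : ∃[ v ] R v × lookup v 4F ≡ x × lookup v 0F ≡ start
        root = let (_ , _ , w , q , (v , enc) , _) = satᵐ t₀∈T t₀∈T in
          v , (t₀ , t₀∈T , enc) , to (enc 4F x) w , to (enc 0F start) q

        laws : ∀ u v → R u → R v → ∀ i → ∃[ w ] R w × ⟦ axioms i ⟧ᶜ (u ∷ v ∷ w ∷ [])
        laws u v (t₁ , t₁∈T , enc₁) (t₂ , t₂∈T , enc₂) i =
          let (ts , ts∈T , _ , _ , _ , h) = satᵐ t₁∈T t₂∈T
              (w , enc₃) = encoded (ts∈T i)
          in w , (ts i , ts∈T i , enc₃) ,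
             to (compile-sat (vars i) (Π-vars t₀ t₁ t₂ ts i)
                  (λ { 0F → enc₁ ; 1F → enc₂ ; 2F → enc₃ }) (axioms i)) (h i)

      fromModel : (∃ λ (R : Tuple → Set) → Model R x) → UPSatisfiable (formula x)
      fromModel (R , (v₀ , v₀∈R , w , q) , laws) =
        T , (λ { _ (v , _ , refl) → traceOf-periodic v }) , traceOf v₀ , (v₀ , v₀∈R , refl) , body
        where
        T : Trace 5 → Set
        T t = ∃[ v ] R v × t ≡ traceOf v

        body : ∀ t₁ → T t₁ → ∀ t₂ → T t₂ →
          T , Π∅ [ 0 ↦ traceOf v₀ ] [ 1 ↦ t₁ ] [ 2 ↦ t₂ ] ⊨ exists 3 N (matrix x)
        body _ (u , u∈R , refl) _ (v , v∈R , refl) = from (exists-sat N (matrix x))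
          (ts , (λ i → _ , proj₁ (proj₂ (law i)) , refl) ,
           from (matrix-sat (traceOf v₀) (traceOf u) (traceOf v) ts x)
             (from (traceOf-encodes v₀ 4F x) w , from (traceOf-encodes v₀ 0F start) q ,
              (u , traceOf-encodes u) , λ i →
              from (compile-sat (vars i) (Π-vars (traceOf v₀) (traceOf u) (traceOf v) ts i)
                (λ { 0F → traceOf-encodes u
                   ; 1F → traceOf-encodes v
                   ; 2F → traceOf-encodes (proj₁ (law i)) })
                (axioms i)) (proj₂ (proj₂ (law i)))))
          where
          law : ∀ i → ∃[ w ] R w × ⟦ axioms i ⟧ᶜ (u ∷ v ∷ w ∷ [])
          law = laws u v u∈R v∈R
          ts : Fin N → Trace 5
          ts i = traceOf (proj₁ (law i))

    reduction : {S : ℕ → Set₁} → (∀ x → S x ⇔ (∃ λ (R : Tuple → Set) → Model R x)) →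
                S ≤ₘ UPSatisfiability
    reduction S⇔ = formula-reduction formula-computable formula-closed
      (λ x → ⇔.trans (S⇔ x) (⇔.sym (formula-sat x)))

-- Reduction of Σ¹₁ formulas

-- Assignments of numbers to de Bruijn variables are coded by single numbers,
-- with two further type 1 variables head and tail as the decoding functions.
data Symbol (k : ℕ) : Set where
  head tail : Symbol k
  user      : Fin k → Symbol k

-- The kinds of claims.  form true χ claims χ and form false χ claims ¬ χ.
data Node (k : ℕ) : Set where
  start plus times : Node k
  fun  : Symbol k → Node k
  term : ∀ {m} → Term k m → Node k
  form : ∀ {m} → Bool → Arithmetic k m → Node k

-- The claims that a claim about `t` can lead to. A variable is resolved by stepping down its index,
-- one `tail` at a time, so its predecessors are listed too; finiteness of the list gives finitely
-- many axioms.
nodesᵗ : Term k m → List (Node k)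
nodesᵗ t = term t ∷ children t
  where
  children : Term k m → List (Node k)
  children (var zero)    = []
  children (var (suc i)) = nodesᵗ (var i)
  children `0       = []
  children `1       = []
  children (s `+ t) = nodesᵗ s ++ nodesᵗ t
  children (s `* t) = nodesᵗ s ++ nodesᵗ t
  children (i `$ t) = nodesᵗ t

nodesᶠ : Bool → Arithmetic k m → List (Node k)
nodesᶠ b χ = form b χ ∷ children χ
  where
  children : Arithmetic k m → List (Node k)
  children (s `≡ t) = nodesᵗ s ++ nodesᵗ t
  children (s `< t) = nodesᵗ s ++ nodesᵗ t
  children (`¬ χ)   = nodesᶠ (not b) χ
  children (χ `∧ θ) = nodesᶠ b χ ++ nodesᶠ b θ
  children (χ `∨ θ) = nodesᶠ b χ ++ nodesᶠ b θ
  children (`∃ χ)   = nodesᶠ b χ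
  children (`∀ χ)   = nodesᶠ b χ

-- The columns of a tuple are a node, the code of an assignment, two arguments
-- (or auxiliary values) and a value.  The index is the position of the tuple in
-- a constraint: 0 is the claim to be justified, 1 an arbitrary claim, and 2 the
-- claim used in the justification.
Q₀ E₀ A₀ B₀ W₀ Q₁ A₁ W₁ Q₂ E₂ A₂ B₂ W₂ : Entry
Q₀ = 0F , 0F
E₀ = 0F , 1F
A₀ = 0F , 2F
B₀ = 0F , 3F
W₀ = 0F , 4F
Q₁ = 1F , 0F
A₁ = 1F , 2F
W₁ = 1F , 4F
Q₂ = 2F , 0F
E₂ = 2F , 1F
A₂ = 2F , 2F
B₂ = 2F , 3F
W₂ = 2F , 4F

-- Rules that justify claims

module Rules {k} (ψ : Arithmetic k 1) (idx : Node k → ℕ) where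

  goto : Node k → Constraint
  goto n = Q₂ ≐# idx n

  sign : Bool → Constraint → Constraint
  sign true  C = C
  sign false C = ∼ C

  -- A constraint sees a single justifying tuple, so data shared by several justifications must be
  -- stored in the claim. Here the columns `A₀` and `B₀` hold the guessed values of the two
  -- operands.
  operands : Term k m → Term k m → List Constraint
  operands s t = (goto (term s) & E₂ ≐ E₀ & W₂ ≐ A₀) ∷ (goto (term t) & E₂ ≐ E₀ & W₂ ≐ B₀) ∷ []

  both either : Bool → Arithmetic k m → Arithmetic k m → List Constraint
  both   b χ θ = (goto (form b χ) & E₂ ≐ E₀) ∷ (goto (form b θ) & E₂ ≐ E₀) ∷ []
  either b χ θ = ((goto (form b χ) ∥ goto (form b θ)) & E₂ ≐ E₀) ∷ []

  -- A₀ is an extension of the assignment E₀ by one value.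
  some : Bool → Arithmetic k (suc m) → List Constraint
  some b χ = (goto (fun tail) & A₂ ≐ A₀ & W₂ ≐ E₀) ∷ (goto (form b χ) & E₂ ≐ A₀) ∷ []

  -- W₀ is the added value; the first two constraints make it run through ℕ.
  every : Node k → Bool → Arithmetic k (suc m) → List Constraint
  every n b χ =
    (goto n & E₂ ≐ E₀ & W₂ ≐# 0) ∷ (goto n & E₂ ≐ E₀ & W₀ ⋖ W₂) ∷
    (goto (fun head) & A₂ ≐ A₀ & W₂ ≐ W₀) ∷ some b χ

  rules : Node k → List Constraint
  -- The root stores the input in `W₀`; this ties it to the value that the assignment `E₀` gives to
  -- the only variable of `ψ`.
  rules start = (goto (fun head) & A₂ ≐ E₀ & W₂ ≐ W₀) ∷ (goto (form true ψ) & E₂ ≐ E₀) ∷ []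
  rules plus  = ((B₀ ≐# 0 & W₀ ≐ A₀) ∥ (goto plus & A₂ ≐ A₀ & B₂ ⋖ B₀ & W₂ ⋖ W₀)) ∷ []
  -- Here E₀ is the product of A₀ and the predecessor of B₀.
  rules times =
    ((B₀ ≐# 0 & W₀ ≐# 0) ∥ (goto times & A₂ ≐ A₀ & B₂ ⋖ B₀ & W₂ ≐ E₀)) ∷
    (B₀ ≐# 0 ∥ (goto plus & A₂ ≐ E₀ & B₂ ≐ A₀ & W₂ ≐ W₀)) ∷ []
  -- The one rule that consults the second tuple: claims about the same function and argument must
  -- agree.
  rules (fun s) =
    (∼ (Q₁ ≐# idx (fun s)) ∥ ∼ (A₁ ≐ A₀) ∥ W₁ ≐ W₀) ∷ []
  rules (term (var zero))    = (goto (fun head) & A₂ ≐ E₀ & W₂ ≐ W₀) ∷ []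
  rules (term {suc m} (var (suc i))) =
    (goto (fun tail) & A₂ ≐ E₀ & W₂ ≐ A₀) ∷ (goto (term {m = m} (var i)) & E₂ ≐ A₀ & W₂ ≐ W₀) ∷ []
  rules (term `0)       = W₀ ≐# 0 ∷ []
  rules (term `1)       = W₀ ≐# 1 ∷ []
  rules (term (s `+ t)) = (goto plus & A₂ ≐ A₀ & B₂ ≐ B₀ & W₂ ≐ W₀) ∷ operands s t
  rules (term (s `* t)) = (goto times & A₂ ≐ A₀ & B₂ ≐ B₀ & W₂ ≐ W₀) ∷ operands s t
  rules (term (i `$ t)) =
    (goto (term t) & E₂ ≐ E₀ & W₂ ≐ A₀) ∷ (goto (fun (user i)) & A₂ ≐ A₀ & W₂ ≐ W₀) ∷ []
  rules (form b (s `≡ t)) = sign b (A₀ ≐ B₀) ∷ operands s t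
  rules (form b (s `< t)) = sign b (A₀ ≺ B₀) ∷ operands s t
  rules (form b (`¬ χ))   = (goto (form (not b) χ) & E₂ ≐ E₀) ∷ []
  rules (form true  (χ `∧ θ)) = both true χ θ
  rules (form false (χ `∧ θ)) = either false χ θ
  rules (form true  (χ `∨ θ)) = either true χ θ
  rules (form false (χ `∨ θ)) = both false χ θ
  rules (form true  (`∃ χ)) = some true χ
  rules (form false (`∃ χ)) = every (form false (`∃ χ)) false χ
  rules (form true  (`∀ χ)) = every (form true (`∀ χ)) true χ
  rules (form false (`∀ χ)) = some false χ

holds : Bool → Set → Set
holds true  P = P
holds false P = ¬ P

module Semantics {k} (F : Vec (ℕ → ℕ) k) (hd tl : ℕ → ℕ) where

  -- The decoding functions are arbitrary here: they are read off the relation in the soundness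
  -- proof and are the projections of `pair` in the completeness proof.
  env : ∀ m → ℕ → Vec ℕ m
  env zero    e = []
  env (suc m) e = hd e ∷ env m (tl e)

  apply : Symbol k → ℕ → ℕ
  apply head     = hd
  apply tail     = tl
  apply (user i) = lookup F i

  value : Term k m → ℕ → ℕ
  value t e = ⟦_⟧ᵗ F t (env _ e)

  claim : Bool → Arithmetic k m → ℕ → Set
  claim b χ e = holds b (⟦_⟧ F χ (env _ e))

-- A closed relation yields functions that satisfy the formula

module SoundRules (em : ExcludedMiddle 0ℓ) {k} (ψ : Arithmetic k 1) (idx : Node k → ℕ)
                  (R : Tuple → Set) where

  open Rules ψ idx

  At : Node k → Tuple → Set
  At n v = R v × lookup v 0F ≡ idx n

  Laws : Node k → List Constraint → Set
  Laws n = All (λ C → ∀ u v → At n u → R v → ∃[ w ] R w × ⟦ C ⟧ᶜ (u ∷ v ∷ w ∷ []))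

  Obeys : Node k → Set
  Obeys n = Laws n (rules n)

  -- The relation may say nothing about some arguments; the function is 0 there. No justification
  -- ever relies on such a value.
  graph : Symbol k → ℕ → ℕ
  graph s a = result (em {∃[ v ] At (fun s) v × lookup v 2F ≡ a})
    where
    result : Dec (∃[ v ] At (fun s) v × lookup v 2F ≡ a) → ℕ
    result (yes (v , _)) = lookup v 4F
    result (no _)        = 0

  F : Vec (ℕ → ℕ) k
  F = tabulate (graph ∘ user)

  open Semantics F (graph head) (graph tail)

  module _ (plus-ok : Obeys plus) (times-ok : Obeys times) (fun-ok : ∀ s → Obeys (fun s)) where

    graph-sound : ∀ s {v} → At (fun s) v → lookup v 4F ≡ graph s (lookup v 2F)
    graph-sound s {v} at@(v∈R , q) with em {∃[ u ] At (fun s) u × lookup u 2F ≡ lookup v 2F}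
    ... | no ¬∃ = ⊥-elim (¬∃ (v , at , refl))
    -- The arbitrary second tuple of the functionality rule is instantiated with the one that
    -- `graph` chose.
    ... | yes (u , (u∈R , q′) , a≡) with All.head (fun-ok s) v u at u∈R
    ...   | _ , _ , inj₁ ¬q        = ⊥-elim (¬q q′)
    ...   | _ , _ , inj₂ (inj₁ ¬a) = ⊥-elim (¬a a≡)
    ...   | _ , _ , inj₂ (inj₂ w≡) = sym w≡

    apply-sound : ∀ s {v} → At (fun s) v → lookup v 4F ≡ apply s (lookup v 2F)
    apply-sound head     at = graph-sound head at
    apply-sound tail     at = graph-sound tail at
    apply-sound (user i) {v} at = trans (graph-sound (user i) at)
      (cong (λ f → f (lookup v 2F)) (sym (lookup∘tabulate (graph ∘ user) i)))

    -- The relation carries no order along which justifications decrease, so the induction is on the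
    -- second summand, which drops by one at each justification.
    plus-sound : ∀ b {v} → At plus v → lookup v 3F ≡ b → lookup v 4F ≡ lookup v 2F + b
    plus-sound b {v} at b≡ with All.head plus-ok v v at (proj₁ at)
    plus-sound b {v} at refl | _ , _ , inj₁ (b≡0 , w≡a) =
      trans w≡a (sym (trans (cong (lookup v 2F +_) b≡0) (+-identityʳ _)))
    plus-sound zero {v} at b≡ | w , w∈R , inj₂ (q , a≡ , sb≡ , sw≡) = case trans sb≡ b≡ of λ ()
    plus-sound (suc b) {v} at b≡ | w , w∈R , inj₂ (q , a≡ , sb≡ , sw≡) = begin
      lookup v 4F           ≡⟨ sw≡ ⟨
      suc (lookup w 4F)     ≡⟨ cong suc (plus-sound b (w∈R , q) (suc-injective (trans sb≡ b≡))) ⟩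
      suc (lookup w 2F + b) ≡⟨ cong (λ a → suc (a + b)) a≡ ⟩
      suc (lookup v 2F + b) ≡⟨ +-suc _ b ⟨
      lookup v 2F + suc b   ∎
      where open ≡-Reasoning

    times-sound : ∀ b {v} → At times v → lookup v 3F ≡ b → lookup v 4F ≡ lookup v 2F * b
    times-sound b {v} at b≡
      with All.head times-ok v v at (proj₁ at) | All.head (All.tail times-ok) v v at (proj₁ at)
    times-sound b {v} at refl | _ , _ , inj₁ (b≡0 , w≡0) | _ =
      trans w≡0 (sym (trans (cong (lookup v 2F *_) b≡0) (*-zeroʳ (lookup v 2F))))
    times-sound zero at b≡ | _ , _ , inj₂ (_ , _ , sb≡ , _) | _ = case trans sb≡ b≡ of λ ()
    times-sound (suc b) at b≡ | _ , _ , inj₂ _ | _ , _ , inj₁ b≡0 = case trans (sym b≡) b≡0 of λ ()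
    times-sound (suc b) {v} at b≡ | w , w∈R , inj₂ (q , a≡ , sb≡ , w≡e)
                                  | u , u∈R , inj₂ (q′ , a′≡ , b′≡ , w′≡) = begin
      lookup v 4F                   ≡⟨ w′≡ ⟨
      lookup u 4F                   ≡⟨ plus-sound _ (u∈R , q′) b′≡ ⟩
      lookup u 2F + lookup v 2F     ≡⟨ cong (_+ lookup v 2F) (trans a′≡ (sym w≡e)) ⟩
      lookup w 4F + lookup v 2F     ≡⟨ cong (_+ lookup v 2F) ab≡ ⟩
      lookup w 2F * b + lookup v 2F ≡⟨ cong (λ a → a * b + lookup v 2F) a≡ ⟩
      lookup v 2F * b + lookup v 2F ≡⟨ +-comm (lookup v 2F * b) _ ⟩
      lookup v 2F + lookup v 2F * b ≡⟨ *-suc (lookup v 2F) b ⟨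
      lookup v 2F * suc b           ∎
      where
      open ≡-Reasoning
      ab≡ : lookup w 4F ≡ lookup w 2F * b
      ab≡ = times-sound b (w∈R , q) (suc-injective (trans sb≡ b≡))

    operands-sound : ∀ {n} {s t : Term k m} →
      (∀ {v} → At (term s) v → lookup v 4F ≡ value s (lookup v 1F)) →
      (∀ {v} → At (term t) v → lookup v 4F ≡ value t (lookup v 1F)) →
      Laws n (operands s t) →
      ∀ {v} → At n v → lookup v 2F ≡ value s (lookup v 1F) × lookup v 3F ≡ value t (lookup v 1F)
    operands-sound {s = s} {t} hs ht (law₁ ∷ law₂ ∷ []) {v} at =
      let (w₁ , w₁∈R , q₁ , e₁ , a≡) = law₁ v v at (proj₁ at)
          (w₂ , w₂∈R , q₂ , e₂ , b≡) = law₂ v v at (proj₁ at)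
      in trans (sym a≡) (trans (hs (w₁∈R , q₁)) (cong (value s) e₁)) ,
         trans (sym b≡) (trans (ht (w₂∈R , q₂)) (cong (value t) e₂))

    term-sound : ∀ (t : Term k m) → All Obeys (nodesᵗ t) →
      ∀ {v} → At (term t) v → lookup v 4F ≡ value t (lookup v 1F)
    term-sound (var zero) ((law ∷ []) ∷ _) {v} at =
      let (w , w∈R , q , a≡ , w≡) = law v v at (proj₁ at)
      in trans (sym w≡) (trans (graph-sound head (w∈R , q)) (cong (graph head) a≡))
    term-sound (var (suc i)) ((law₁ ∷ law₂ ∷ []) ∷ ok) {v} at =
      let (w₁ , w₁∈R , q₁ , a≡e , w≡a) = law₁ v v at (proj₁ at)
          (w₂ , w₂∈R , q₂ , e≡a , w≡) = law₂ v v at (proj₁ at)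
          tail≡ = trans (sym w≡a) (trans (graph-sound tail (w₁∈R , q₁)) (cong (graph tail) a≡e))
      in trans (sym w≡)
           (trans (term-sound (var i) ok (w₂∈R , q₂)) (cong (value (var i)) (trans e≡a tail≡)))
    term-sound `0 ((law ∷ []) ∷ _) {v} at = proj₂ (proj₂ (law v v at (proj₁ at)))
    term-sound `1 ((law ∷ []) ∷ _) {v} at = proj₂ (proj₂ (law v v at (proj₁ at)))
    term-sound (s `+ t) ((law ∷ ops) ∷ ok) {v} at =
      let (ok₁ , ok₂) = All.++⁻ (nodesᵗ s) ok
          (a≡ , b≡) = operands-sound (term-sound s ok₁) (term-sound t ok₂) ops at
          (w , w∈R , q , a′≡ , b′≡ , w≡) = law v v at (proj₁ at)
      in trans (sym w≡) (trans (plus-sound _ (w∈R , q) b′≡) (cong₂ _+_ (trans a′≡ a≡) b≡))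
    term-sound (s `* t) ((law ∷ ops) ∷ ok) {v} at =
      let (ok₁ , ok₂) = All.++⁻ (nodesᵗ s) ok
          (a≡ , b≡) = operands-sound (term-sound s ok₁) (term-sound t ok₂) ops at
          (w , w∈R , q , a′≡ , b′≡ , w≡) = law v v at (proj₁ at)
      in trans (sym w≡) (trans (times-sound _ (w∈R , q) b′≡) (cong₂ _*_ (trans a′≡ a≡) b≡))
    term-sound (i `$ t) ((law₁ ∷ law₂ ∷ []) ∷ ok) {v} at =
      let (w₁ , w₁∈R , q₁ , e≡ , w≡a) = law₁ v v at (proj₁ at)
          (w₂ , w₂∈R , q₂ , a≡ , w≡) = law₂ v v at (proj₁ at)
          arg≡ = trans (sym w≡a) (trans (term-sound t ok (w₁∈R , q₁)) (cong (value t) e≡))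
      in trans (sym w≡) (trans (apply-sound (user i) (w₂∈R , q₂)) (cong (lookup F i) (trans a≡ arg≡)))

    Sound : Bool → Arithmetic k m → Set
    Sound b χ = ∀ {v} → At (form b χ) v → claim b χ (lookup v 1F)

    sign-sound : ∀ b C {vs} {P : Set} → ⟦ sign b C ⟧ᶜ vs → (⟦ C ⟧ᶜ vs ⇔ P) → holds b P
    sign-sound true  C h e = to e h
    sign-sound false C h e = h ∘ from e

    both-sound : ∀ {n} b {χ θ : Arithmetic k m} → Sound b χ → Sound b θ → Laws n (both b χ θ) →
      ∀ {v} → At n v → claim b χ (lookup v 1F) × claim b θ (lookup v 1F)
    both-sound b {χ} {θ} hχ hθ (law₁ ∷ law₂ ∷ []) {v} at =
      let (w₁ , w₁∈R , q₁ , e₁) = law₁ v v at (proj₁ at)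
          (w₂ , w₂∈R , q₂ , e₂) = law₂ v v at (proj₁ at)
      in subst (claim b χ) e₁ (hχ (w₁∈R , q₁)) , subst (claim b θ) e₂ (hθ (w₂∈R , q₂))

    either-sound : ∀ {n} b {χ θ : Arithmetic k m} → Sound b χ → Sound b θ → Laws n (either b χ θ) →
      ∀ {v} → At n v → claim b χ (lookup v 1F) ⊎ claim b θ (lookup v 1F)
    either-sound b {χ} {θ} hχ hθ (law ∷ []) {v} at with law v v at (proj₁ at)
    ... | w , w∈R , inj₁ q , e≡ = inj₁ (subst (claim b χ) e≡ (hχ (w∈R , q)))
    ... | w , w∈R , inj₂ q , e≡ = inj₂ (subst (claim b θ) e≡ (hθ (w∈R , q)))

    some-sound : ∀ {n} b {χ : Arithmetic k (suc m)} → Sound b χ → Laws n (some b χ) →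
      ∀ {v} → At n v → graph tail (lookup v 2F) ≡ lookup v 1F × claim b χ (lookup v 2F)
    some-sound b {χ} hχ (law₁ ∷ law₂ ∷ []) {v} at =
      let (w₁ , w₁∈R , q₁ , a≡ , w≡e) = law₁ v v at (proj₁ at)
          (w₂ , w₂∈R , q₂ , e≡a) = law₂ v v at (proj₁ at)
      in trans (cong (graph tail) (sym a≡)) (trans (sym (graph-sound tail (w₁∈R , q₁))) w≡e) ,
         subst (claim b χ) e≡a (hχ (w₂∈R , q₂))

    -- `reach` finds a copy of the claim whose value column is `x`: one constraint supplies the copy
    -- for 0, the next leads from each copy to its successor. Column `A₀` of that copy codes the
    -- assignment extended by `x`.
    every-sound : ∀ {n} b {χ : Arithmetic k (suc m)} → Sound b χ → Laws n (every n b χ) →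
      ∀ {v} → At n v → ∀ x → holds b (⟦_⟧ F χ (x ∷ env m (lookup v 1F)))
    every-sound {m} {n} b {χ} hχ (law₀ ∷ law₊ ∷ lawʰ ∷ laws) {v} at x =
      let (u , at-u , e≡ , w≡x) = reach x
          (w , w∈R , q , a≡ , w≡) = lawʰ u u at-u (proj₁ at-u)
          (tail≡ , c) = some-sound b hχ laws at-u
          head≡ = trans (cong (graph head) (sym a≡))
                    (trans (sym (graph-sound head (w∈R , q))) (trans w≡ w≡x))
      in subst (λ ρ → holds b (⟦_⟧ F χ ρ)) (cong₂ (λ y e → y ∷ env m e) head≡ (trans tail≡ e≡)) c
      where
      reach : ∀ x → ∃[ u ] At n u × lookup u 1F ≡ lookup v 1F × lookup u 4F ≡ x
      reach zero =
        let (w , w∈R , q , e≡ , w≡0) = law₀ v v at (proj₁ at) in w , (w∈R , q) , e≡ , w≡0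
      reach (suc x) =
        let (u , at-u , e≡ , w≡x) = reach x
            (w , w∈R , q , e′≡ , sw≡) = law₊ u u at-u (proj₁ at-u)
        in w , (w∈R , q) , trans e′≡ e≡ , trans (sym sw≡) (cong suc w≡x)

    -- The induction covers both polarities at once, since the claim under a negation has the
    -- opposite sign.
    form-sound : ∀ b (χ : Arithmetic k m) → All Obeys (nodesᶠ b χ) → Sound b χ
    form-sound b (s `≡ t) ((law ∷ ops) ∷ ok) {v} at =
      let (ok₁ , ok₂) = All.++⁻ (nodesᵗ s) ok
          (a≡ , b≡) = operands-sound (term-sound s ok₁) (term-sound t ok₂) ops at
      in sign-sound b (A₀ ≐ B₀) (proj₂ (proj₂ (law v v at (proj₁ at)))) (≡⇒⇔ (cong₂ _≡_ a≡ b≡))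
    form-sound b (s `< t) ((law ∷ ops) ∷ ok) {v} at =
      let (ok₁ , ok₂) = All.++⁻ (nodesᵗ s) ok
          (a≡ , b≡) = operands-sound (term-sound s ok₁) (term-sound t ok₂) ops at
      in sign-sound b (A₀ ≺ B₀) (proj₂ (proj₂ (law v v at (proj₁ at)))) (≡⇒⇔ (cong₂ _<_ a≡ b≡))
    form-sound b (`¬ χ) ((law ∷ []) ∷ ok) {v} at =
      let (w , w∈R , q , e≡) = law v v at (proj₁ at)
      in flip b (subst (claim (not b) χ) e≡ (form-sound (not b) χ ok (w∈R , q)))
      where
      flip : ∀ b {P} → holds (not b) P → holds b (¬ P)
      flip true  h = h
      flip false h = λ ¬p → ¬p h
    form-sound true (χ `∧ θ) (laws ∷ ok) at =
      let (ok₁ , ok₂) = All.++⁻ (nodesᶠ true χ) ok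
      in both-sound true (form-sound true χ ok₁) (form-sound true θ ok₂) laws at
    form-sound false (χ `∧ θ) (laws ∷ ok) at (p , q) =
      let (ok₁ , ok₂) = All.++⁻ (nodesᶠ false χ) ok
      in [ (λ ¬p → ¬p p) , (λ ¬q → ¬q q) ]′
           (either-sound false (form-sound false χ ok₁) (form-sound false θ ok₂) laws at)
    form-sound true (χ `∨ θ) (laws ∷ ok) at =
      let (ok₁ , ok₂) = All.++⁻ (nodesᶠ true χ) ok
      in either-sound true (form-sound true χ ok₁) (form-sound true θ ok₂) laws at
    form-sound false (χ `∨ θ) (laws ∷ ok) at =
      let (ok₁ , ok₂) = All.++⁻ (nodesᶠ false χ) ok
          (¬p , ¬q) = both-sound false (form-sound false χ ok₁) (form-sound false θ ok₂) laws at
      in [ ¬p , ¬q ]′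
    form-sound true (`∃ χ) (laws ∷ ok) {v} at =
      let (tail≡ , c) = some-sound true (form-sound true χ ok) laws at
          x = graph head (lookup v 2F)
      in x , subst (λ e → ⟦_⟧ F χ (x ∷ env _ e)) tail≡ c
    form-sound false (`∃ χ) (laws ∷ ok) at (x , p) =
      every-sound false (form-sound false χ ok) laws at x p
    form-sound true (`∀ χ) (laws ∷ ok) at = every-sound true (form-sound true χ ok) laws at
    form-sound false (`∀ χ) (laws ∷ ok) {v} at p =
      let (tail≡ , c) = some-sound false (form-sound false χ ok) laws at
          x = graph head (lookup v 2F)
      in subst (λ e → ¬ ⟦_⟧ F χ (x ∷ env _ e)) tail≡ c (p x)

    start-sound : Obeys start → All Obeys (nodesᶠ true ψ) →
      ∀ {v} → At start v → ⟦_⟧ F ψ [ lookup v 4F ]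
    start-sound (law₁ ∷ law₂ ∷ []) ok {v} at =
      let (w₁ , w₁∈R , q₁ , a≡e , w≡) = law₁ v v at (proj₁ at)
          (w₂ , w₂∈R , q₂ , e≡) = law₂ v v at (proj₁ at)
      in subst (λ x → ⟦_⟧ F ψ [ x ])
           (trans (cong (graph head) (trans e≡ (sym a≡e)))
             (trans (sym (graph-sound head (w₁∈R , q₁))) w≡))
           (form-sound true ψ ok (w₂∈R , q₂))

-- The true claims form a closed relation

module CompleteRules (em : ExcludedMiddle 0ℓ) {k} (ψ : Arithmetic k 1) (idx : Node k → ℕ)
  (idx-fun : ∀ s {n} → idx (fun s) ≡ idx n → fun s ≡ n)
  (F : Vec (ℕ → ℕ) k) (hd tl : ℕ → ℕ) (cons : ℕ → ℕ → ℕ)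
  (hd-cons : ∀ x e → hd (cons x e) ≡ x) (tl-cons : ∀ x e → tl (cons x e) ≡ e)
  where

  open Rules ψ idx
  open Semantics F hd tl

  -- A true claim with arbitrary auxiliary columns may violate the rules, so the relation admits
  -- only claims whose auxiliary columns have the contents that the rules check.
  witnessᵗ : Term k m → (e a b : ℕ) → Set
  witnessᵗ (var zero)    e a b = ⊤
  witnessᵗ (var (suc i)) e a b = a ≡ tl e
  witnessᵗ `0       e a b = ⊤
  witnessᵗ `1       e a b = ⊤
  witnessᵗ (s `+ t) e a b = a ≡ value s e × b ≡ value t e
  witnessᵗ (s `* t) e a b = a ≡ value s e × b ≡ value t e
  witnessᵗ (i `$ t) e a b = a ≡ value t e

  witnessᶠ : Bool → Arithmetic k m → (e a b w : ℕ) → Set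
  witnessᶠ p (s `≡ t) e a b w = a ≡ value s e × b ≡ value t e
  witnessᶠ p (s `< t) e a b w = a ≡ value s e × b ≡ value t e
  witnessᶠ p (`¬ χ)   e a b w = ⊤
  witnessᶠ p (χ `∧ θ) e a b w = ⊤
  witnessᶠ p (χ `∨ θ) e a b w = ⊤
  witnessᶠ true  (`∃ χ) e a b w = tl a ≡ e × claim true χ a
  witnessᶠ false (`∃ χ) e a b w = tl a ≡ e × hd a ≡ w
  witnessᶠ true  (`∀ χ) e a b w = tl a ≡ e × hd a ≡ w
  witnessᶠ false (`∀ χ) e a b w = tl a ≡ e × claim false χ a

  meaning : Node k → Tuple → Set
  meaning start      (_ ∷ e ∷ _ ∷ _ ∷ w ∷ []) = w ≡ hd e × ⟦_⟧ F ψ (env 1 e)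
  meaning plus       (_ ∷ _ ∷ a ∷ b ∷ w ∷ []) = w ≡ a + b
  meaning times      (_ ∷ e ∷ a ∷ b ∷ w ∷ []) = w ≡ a * b × (b ≡ 0 ⊎ (∃[ c ] suc c ≡ b × e ≡ a * c))
  meaning (fun s)    (_ ∷ _ ∷ a ∷ _ ∷ w ∷ []) = w ≡ apply s a
  meaning (term t)   (_ ∷ e ∷ a ∷ b ∷ w ∷ []) = w ≡ value t e × witnessᵗ t e a b
  meaning (form p χ) (_ ∷ e ∷ a ∷ b ∷ w ∷ []) = claim p χ e × witnessᶠ p χ e a b w

  R : Tuple → Set
  R v = ∃[ n ] lookup v 0F ≡ idx n × meaning n v

  R-plus : ∀ a b → R (idx plus ∷ 0 ∷ a ∷ b ∷ a + b ∷ [])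
  R-plus a b = plus , refl , refl

  R-times : ∀ a b → ∃[ e ] R (idx times ∷ e ∷ a ∷ b ∷ a * b ∷ [])
  R-times a zero    = 0 , times , refl , refl , inj₁ refl
  R-times a (suc b) = a * b , times , refl , refl , inj₂ (b , refl , refl)

  R-fun : ∀ s a → R (idx (fun s) ∷ 0 ∷ a ∷ 0 ∷ apply s a ∷ [])
  R-fun s a = fun s , refl , refl

  R-term : ∀ (t : Term k m) e → ∃[ a ] ∃[ b ] R (idx (term t) ∷ e ∷ a ∷ b ∷ value t e ∷ [])
  R-term t e = let (a , b , wit) = witness t in a , b , term t , refl , refl , wit
    where
    witness : ∀ t → ∃[ a ] ∃[ b ] witnessᵗ t e a b
    witness (var zero)    = 0 , 0 , tt
    witness (var (suc i)) = tl e , 0 , refl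
    witness `0       = 0 , 0 , tt
    witness `1       = 0 , 0 , tt
    witness (s `+ t) = value s e , value t e , refl , refl
    witness (s `* t) = value s e , value t e , refl , refl
    witness (i `$ t) = value t e , 0 , refl

  claim-cons : ∀ p (χ : Arithmetic k (suc m)) x e → holds p (⟦_⟧ F χ (x ∷ env m e)) →
               claim p χ (cons x e)
  claim-cons p χ x e = subst (λ ρ → holds p (⟦_⟧ F χ ρ))
    (sym (cong₂ (λ y d → y ∷ env _ d) (hd-cons x e) (tl-cons x e)))

  R-form : ∀ p (χ : Arithmetic k m) e → claim p χ e →
           ∃[ a ] ∃[ b ] ∃[ w ] R (idx (form p χ) ∷ e ∷ a ∷ b ∷ w ∷ [])
  R-form p χ e c = let (a , b , w , wit) = witness p χ c in a , b , w , form p χ , refl , c , wit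
    where
    witness : ∀ p χ → claim p χ e → ∃[ a ] ∃[ b ] ∃[ w ] witnessᶠ p χ e a b w
    witness p (s `≡ t) c = value s e , value t e , 0 , refl , refl
    witness p (s `< t) c = value s e , value t e , 0 , refl , refl
    witness p (`¬ χ)   c = 0 , 0 , 0 , tt
    witness p (χ `∧ θ) c = 0 , 0 , 0 , tt
    witness p (χ `∨ θ) c = 0 , 0 , 0 , tt
    witness true  (`∃ χ) (x , h) = cons x e , 0 , 0 , tl-cons x e , claim-cons true χ x e h
    witness false (`∃ χ) c = cons 0 e , 0 , 0 , tl-cons 0 e , hd-cons 0 e
    witness true  (`∀ χ) c = cons 0 e , 0 , 0 , tl-cons 0 e , hd-cons 0 e
    -- A refuted universal claim must name a counterexample, which excluded middle provides.
    witness false (`∀ χ) c = case em {∃[ x ] ¬ ⟦_⟧ F χ (x ∷ env _ e)} of λ where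
      (yes (x , h)) → cons x e , 0 , 0 , tl-cons x e , claim-cons false χ x e h
      (no ¬∃)       → ⊥-elim (c λ x → decidable-stable em λ ¬h → ¬∃ (x , ¬h))

  module _ (v : Tuple) (v∈R : R v) where

    Meets : Tuple → Constraint → Set
    Meets u C = ∃[ w ] R w × ⟦ C ⟧ᶜ (u ∷ v ∷ w ∷ [])

    operands-meet : ∀ (s t : Term k m) {q e w} →
      All (Meets (q ∷ e ∷ value s e ∷ value t e ∷ w ∷ [])) (operands s t)
    operands-meet s t {e = e} =
      (let (_ , _ , r) = R-term s e in _ , r , refl , refl , refl) ∷
      (let (_ , _ , r) = R-term t e in _ , r , refl , refl , refl) ∷ []

    form-meets : ∀ p (χ : Arithmetic k m) u → claim p χ (lookup u 1F) →
                 Meets u (goto (form p χ) & E₂ ≐ E₀)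
    form-meets p χ u c = let (_ , _ , _ , r) = R-form p χ _ c in _ , r , refl , refl

    both-meet : ∀ p (χ θ : Arithmetic k m) u → claim p χ (lookup u 1F) → claim p θ (lookup u 1F) →
      All (Meets u) (both p χ θ)
    both-meet p χ θ u c d = form-meets p χ u c ∷ form-meets p θ u d ∷ []

    either-meets : ∀ p (χ θ : Arithmetic k m) u → claim p χ (lookup u 1F) ⊎ claim p θ (lookup u 1F) →
      All (Meets u) (either p χ θ)
    either-meets p χ θ u (inj₁ c) =
      (let (_ , _ , _ , r) = R-form p χ _ c in _ , r , inj₁ refl , refl) ∷ []
    either-meets p χ θ u (inj₂ c) =
      (let (_ , _ , _ , r) = R-form p θ _ c in _ , r , inj₂ refl , refl) ∷ []

    some-meets : ∀ p (χ : Arithmetic k (suc m)) {q e a b w} → tl a ≡ e → claim p χ a →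
      All (Meets (q ∷ e ∷ a ∷ b ∷ w ∷ [])) (some p χ)
    some-meets p χ {a = a} tl≡ c =
      (_ , R-fun tail a , refl , refl , tl≡) ∷
      (let (_ , _ , _ , r) = R-form p χ a c in _ , r , refl , refl) ∷ []

    every-meets : ∀ n p (χ : Arithmetic k (suc m)) {q e a b w} →
      (∀ x → R (idx n ∷ e ∷ cons x e ∷ 0 ∷ x ∷ [])) → tl a ≡ e → hd a ≡ w → claim p χ a →
      All (Meets (q ∷ e ∷ a ∷ b ∷ w ∷ [])) (every n p χ)
    every-meets n p χ {a = a} {w = w} r tl≡ hd≡ c =
      (_ , r 0 , refl , refl , refl) ∷ (_ , r (suc w) , refl , refl , refl) ∷
      (_ , R-fun head a , refl , refl , hd≡) ∷ some-meets p χ tl≡ c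

    -- A constraint on the claim alone still asks for some third tuple in the relation; the claim
    -- itself serves.
    sign-meets : ∀ p C {u} → R u → (∀ {w} → holds p (⟦ C ⟧ᶜ (u ∷ v ∷ w ∷ []))) → Meets u (sign p C)
    sign-meets true  C {u} u∈R h = u , u∈R , h {u}
    sign-meets false C {u} u∈R h = u , u∈R , h {u}

    rules-meet : ∀ n u → lookup u 0F ≡ idx n → meaning n u → All (Meets u) (rules n)
    rules-meet start u@(_ ∷ e ∷ a ∷ b ∷ w ∷ []) q (refl , h) =
      (_ , R-fun head e , refl , refl , refl) ∷ form-meets true ψ u h ∷ []
    rules-meet plus u@(_ ∷ e ∷ a ∷ zero ∷ w ∷ []) q h =
      (u , (plus , q , h) , inj₁ (refl , trans h (+-identityʳ a))) ∷ []
    rules-meet plus (_ ∷ e ∷ a ∷ suc b ∷ w ∷ []) q h =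
      (_ , R-plus a b , inj₂ (refl , refl , refl , trans (sym (+-suc a b)) (sym h))) ∷ []
    rules-meet times u@(_ ∷ e ∷ a ∷ b ∷ w ∷ []) q h@(w≡ , inj₁ refl) =
      (u , (times , q , h) , inj₁ (refl , trans w≡ (*-zeroʳ a))) ∷
      (u , (times , q , h) , inj₁ refl) ∷ []
    rules-meet times (_ ∷ e ∷ a ∷ b ∷ w ∷ []) q (refl , inj₂ (c , refl , refl)) =
      (let (_ , r) = R-times a c in _ , r , inj₂ (refl , refl , refl , refl)) ∷
      (_ , R-plus (a * c) a ,
       inj₂ (refl , refl , refl , trans (+-comm (a * c) a) (sym (*-suc a c)))) ∷ []
    -- If the second tuple carries the number of `fun s`, then `idx-fun` shows that it really is a
    -- claim about `s`, so both values equal `apply s a`.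
    rules-meet (fun s) u@(_ ∷ e ∷ a ∷ b ∷ w ∷ []) q h = law v v∈R ∷ []
      where
      law : ∀ v → R v → ∃[ w ] R w × ⟦ ∼ (Q₁ ≐# idx (fun s)) ∥ ∼ (A₁ ≐ A₀) ∥ W₁ ≐ W₀ ⟧ᶜ (u ∷ v ∷ w ∷ [])
      law v v∈R with lookup v 0F ≟ idx (fun s) | lookup v 2F ≟ a
      ... | no ¬q | _     = u , (fun s , q , h) , inj₁ ¬q
      ... | yes _ | no ¬a = u , (fun s , q , h) , inj₂ (inj₁ ¬a)
      law (_ ∷ _ ∷ _ ∷ _ ∷ _ ∷ []) (n , q′ , h′) | yes q″ | yes refl with idx-fun s (trans (sym q″) q′)
      ... | refl = u , (fun s , q , h) , inj₂ (inj₂ (trans h′ (sym h)))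
    rules-meet (term (var zero)) (_ ∷ e ∷ a ∷ b ∷ w ∷ []) q (w≡ , _) =
      (_ , R-fun head e , refl , refl , sym w≡) ∷ []
    rules-meet (term (var (suc i))) (_ ∷ e ∷ a ∷ b ∷ w ∷ []) q (refl , refl) =
      (_ , R-fun tail e , refl , refl , refl) ∷
      (let (_ , _ , r) = R-term (var i) (tl e) in _ , r , refl , refl , refl) ∷ []
    rules-meet (term `0) u@(_ ∷ e ∷ a ∷ b ∷ w ∷ []) q h = (u , (term `0 , q , h) , proj₁ h) ∷ []
    rules-meet (term `1) u@(_ ∷ e ∷ a ∷ b ∷ w ∷ []) q h = (u , (term `1 , q , h) , proj₁ h) ∷ []
    rules-meet (term (s `+ t)) (_ ∷ e ∷ a ∷ b ∷ w ∷ []) q (refl , refl , refl) =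
      (_ , R-plus a b , refl , refl , refl , refl) ∷ operands-meet s t
    rules-meet (term (s `* t)) (_ ∷ e ∷ a ∷ b ∷ w ∷ []) q (refl , refl , refl) =
      (let (_ , r) = R-times a b in _ , r , refl , refl , refl , refl) ∷ operands-meet s t
    rules-meet (term (i `$ t)) (_ ∷ e ∷ a ∷ b ∷ w ∷ []) q (refl , refl) =
      (let (_ , _ , r) = R-term t e in _ , r , refl , refl , refl) ∷
      (_ , R-fun (user i) a , refl , refl , refl) ∷ []
    rules-meet (form p (s `≡ t)) u@(_ ∷ e ∷ a ∷ b ∷ w ∷ []) q h@(c , refl , refl) =
      sign-meets p (A₀ ≐ B₀) (form p (s `≡ t) , q , h) c ∷ operands-meet s t
    rules-meet (form p (s `< t)) u@(_ ∷ e ∷ a ∷ b ∷ w ∷ []) q h@(c , refl , refl) =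
      sign-meets p (A₀ ≺ B₀) (form p (s `< t) , q , h) c ∷ operands-meet s t
    rules-meet (form true (`¬ χ)) u@(_ ∷ e ∷ a ∷ b ∷ w ∷ []) q (c , _) = form-meets false χ u c ∷ []
    rules-meet (form false (`¬ χ)) u@(_ ∷ e ∷ a ∷ b ∷ w ∷ []) q (c , _) =
      form-meets true χ u (decidable-stable em c) ∷ []
    rules-meet (form true (χ `∧ θ)) u@(_ ∷ e ∷ a ∷ b ∷ w ∷ []) q ((c , d) , _) =
      both-meet true χ θ u c d
    rules-meet (form false (χ `∧ θ)) u@(_ ∷ e ∷ a ∷ b ∷ w ∷ []) q (c , _) =
      either-meets false χ θ u (imply em λ p q → c (p , q))
    rules-meet (form true (χ `∨ θ)) u@(_ ∷ e ∷ a ∷ b ∷ w ∷ []) q (c , _) = either-meets true χ θ u c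
    rules-meet (form false (χ `∨ θ)) u@(_ ∷ e ∷ a ∷ b ∷ w ∷ []) q (c , _) =
      both-meet false χ θ u (c ∘ inj₁) (c ∘ inj₂)
    rules-meet (form true (`∃ χ)) (_ ∷ e ∷ a ∷ b ∷ w ∷ []) q (c , tl≡ , d) = some-meets true χ tl≡ d
    rules-meet (form false (`∃ χ)) (_ ∷ e ∷ a ∷ b ∷ w ∷ []) q (c , refl , hd≡) =
      every-meets (form false (`∃ χ)) false χ
      (λ x → form false (`∃ χ) , refl , c , tl-cons x e , hd-cons x e) refl hd≡ (λ h → c (hd a , h))
    rules-meet (form true (`∀ χ)) (_ ∷ e ∷ a ∷ b ∷ w ∷ []) q (c , refl , hd≡) =
      every-meets (form true (`∀ χ)) true χ
      (λ x → form true (`∀ χ) , refl , c , tl-cons x e , hd-cons x e) refl hd≡ (c (hd a))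
    rules-meet (form false (`∀ χ)) (_ ∷ e ∷ a ∷ b ∷ w ∷ []) q (c , tl≡ , d) =
      some-meets false χ tl≡ d

-- Numbering of the nodes and hardness

module _ (em : ExcludedMiddle 0ℓ) where

  -- The numbering is obtained classically, but for a given `ψ` its values are constants of the
  -- sentence, so the reduction stays computable.
  position : ∀ {X : Set} → List X → X → ℕ
  position []       x = 0
  position (y ∷ ys) x = if does (em {x ≡ y}) then 0 else suc (position ys x)

  -- One listed element is enough: unlisted elements all receive the length of the list, which no
  -- listed element does.
  position-injective : ∀ {X : Set} {xs : List X} {x y} → x ∈ˡ xs → position xs x ≡ position xs y → x ≡ y
  position-injective {xs = z ∷ zs} {x} {y} x∈ eq with em {x ≡ z} | em {y ≡ z} | x∈ | eq
  ... | yes p | yes q | _        | _   = trans p (sym q)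
  ... | no ¬p | _     | here p   | _   = ⊥-elim (¬p p)
  ... | no _  | no _  | there x∈ | eq′ = position-injective x∈ (suc-injective eq′)

  module Hardness {k} (ψ : Arithmetic k 1) where

    nodes : List (Node k)
    nodes = start ∷ plus ∷ times ∷ fun head ∷ fun tail ∷
            List.map (fun ∘ user) (allFin k) ++ nodesᶠ true ψ

    idx : Node k → ℕ
    idx = position nodes

    open Rules ψ idx

    -- The universal quantifiers of the sentence range over all tuples; the guard confines a rule to
    -- the claims at its own node.
    guard : Node k → Constraint → Constraint
    guard n C = ∼ (Q₀ ≐# idx n) ∥ C

    guarded : Node k → List Constraint
    guarded n = List.map (guard n) (rules n)

    axiomList : List Constraint
    axiomList = concatMap guarded nodes

    open TupleLogic em (idx start) (length axiomList) (List.lookup axiomList)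

    fun∈nodes : ∀ s → fun s ∈ˡ nodes
    fun∈nodes head     = there (there (there (here refl)))
    fun∈nodes tail     = there (there (there (there (here refl))))
    fun∈nodes (user i) =
      there (there (there (there (there (∈-++⁺ˡ (∈-map⁺ (fun ∘ user) (∈-allFin i)))))))

    model-sound : ∀ x R → Model R x → ∃ λ F → ⟦_⟧ F ψ [ x ]
    model-sound x R ((v , v∈R , w≡x , q) , laws) =
      F , subst (λ y → ⟦_⟧ F ψ [ y ]) w≡x
        (start-sound (obeys (there (here refl))) (obeys (there (there (here refl)))) (obeys ∘ fun∈nodes)
          (obeys (here refl)) (All.tabulate (obeys ∘ ψ-nodes)) (v∈R , q))
      where
      open SoundRules em ψ idx R

      ψ-nodes : ∀ {n} → n ∈ˡ nodesᶠ true ψ → n ∈ˡ nodes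
      ψ-nodes n∈ = there (there (there (there (there (∈-++⁺ʳ (List.map (fun ∘ user) (allFin k)) n∈)))))

      Law : Constraint → Set
      Law C = ∀ u v → R u → R v → ∃[ w ] R w × ⟦ C ⟧ᶜ (u ∷ v ∷ w ∷ [])

      axioms-hold : All Law axiomList
      axioms-hold = All.tabulate λ C∈ u v u∈R v∈R →
        subst (λ C → ∃[ w ] R w × ⟦ C ⟧ᶜ (u ∷ v ∷ w ∷ [])) (sym (lookup-index C∈))
          (laws u v u∈R v∈R (index C∈))

      unguard : ∀ {n C} → Law (guard n C) → ∀ u v → At n u → R v → ∃[ w ] R w × ⟦ C ⟧ᶜ (u ∷ v ∷ w ∷ [])
      unguard law u v (u∈R , q) v∈R = let (w , w∈R , h) = law u v u∈R v∈R in w , w∈R , implies h q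

      obeys : ∀ {n} → n ∈ˡ nodes → Obeys n
      obeys {n} n∈ = All.map (λ {C} → unguard {n} {C}) (All.map⁻ {P = Law} {f = guard n}
        (All.lookup (All.map⁻ {P = All Law} {f = guarded}
          (All.concat⁻ {xss = List.map guarded nodes} axioms-hold)) n∈))

    model-complete : ∀ x F → ⟦_⟧ F ψ [ x ] → ∃ λ R → Model R x
    model-complete x F h =
      R , (root , (start , refl , sym (hd-cons x 0) , root-true) , refl , refl) , laws
      where
      unpair : ℕ → ℕ × ℕ
      unpair = proj₁ (Classical.unpairing em)
      hd tl : ℕ → ℕ
      hd = proj₁ ∘ unpair
      tl = proj₂ ∘ unpair
      hd-cons : ∀ x e → hd (pair x e) ≡ x
      hd-cons x e = cong proj₁ (proj₂ (Classical.unpairing em) (x , e))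
      tl-cons : ∀ x e → tl (pair x e) ≡ e
      tl-cons x e = cong proj₂ (proj₂ (Classical.unpairing em) (x , e))

      open CompleteRules em ψ idx (λ s → position-injective (fun∈nodes s)) F hd tl pair hd-cons tl-cons

      root : Tuple
      root = idx start ∷ pair x 0 ∷ 0 ∷ 0 ∷ x ∷ []

      root-true : ⟦_⟧ F ψ [ hd (pair x 0) ]
      root-true = subst (λ y → ⟦_⟧ F ψ [ y ]) (sym (hd-cons x 0)) h

      laws : ∀ u v → R u → R v → ∀ i → ∃[ w ] R w × ⟦ List.lookup axiomList i ⟧ᶜ (u ∷ v ∷ w ∷ [])
      laws u v u∈R@(n′ , q′ , h′) v∈R i = All.lookup meets (∈-lookup {xs = axiomList} i)
        where
        node-meets : ∀ {n} → n ∈ˡ nodes → All (Meets v v∈R u ∘ guard n) (rules n)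
        node-meets {n} n∈ with lookup u 0F ≟ idx n
        ... | no ¬q = All.universal (λ C → u , u∈R , inj₁ ¬q) (rules n)
        ... | yes q with position-injective n∈ (trans (sym q) q′)
        ...   | refl = All.map (λ (w , w∈R , h) → w , w∈R , inj₂ h) (rules-meet v v∈R n u q h′)

        meets : All (Meets v v∈R u) axiomList
        meets = All.concat⁺ {xss = List.map guarded nodes}
          (All.map⁺ {f = guarded} (All.tabulate λ n∈ → All.map⁺ (node-meets n∈)))

  up-hard : ∀ (S : ℕ → Set₁) → Σ¹₁ S → S ≤ₘ UPSatisfiability
  up-hard S (k , ψ , S⇔) = reduction λ x → ⇔.trans (S⇔ x) (mk⇔
    (λ (F , h) → model-complete x F h) (λ (R , m) → model-sound x R m))
    where
    open Hardness ψ
    open TupleLogic em (idx start) (length axiomList) (List.lookup axiomList) using (reduction)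

theorem2 : ExcludedMiddle (Level.suc 0ℓ) → Σ¹₁-Complete UPSatisfiability
theorem2 em = Classical.up-Σ¹₁ em₀ , up-hard em₀
  where
  em₀ : ExcludedMiddle 0ℓ
  em₀ {P} = map′ lower lift (em {Level.Lift (Level.suc 0ℓ) P})
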